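{- Let $f=a_0+a_1 z+\cdots+a_mz^m\in \mathbb{Z}[z]$ be primitive (the greatest common divisor of its coefficients is $1$). Suppose there exists a positive real number $\alpha$ such that \[ |a_m| \alpha^m>|a_0|+|a_1|\alpha+\cdots+|a_{m-1}|\alpha^{m-1}. \] Further, suppose there exist natural numbers $n$, $d$, $k$, $\ell \leq m$, and a prime $p$ with $p\nmid d$ such that $n\geq \alpha+d$, $f(n)=\pm p^k d$, $\gcd(k,\ell)=1$, $p^k$ divides $\frac{f^{(i)}(n)}{i!}$ for each $i=0, 1, \ldots,\ell-1$, and, in case $k>1$, also $p\nmid \frac{f^{(\ell)}(n)}{\ell!}$. Then $f$ is irreducible in $\mathbb{Z}[z]$.
   Context: $f^{(i)}$ denotes the $i$-th derivative of $f$ with respect to $z$. Natural numbers are positive integers. -}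

module Defs where

open import Algebra.Bundles using (RawSemiring)
import Algebra.Definitions.RawSemiring as RawSemiringDefinitions
open import Data.Integer.Base as ℤ using (ℤ; +_; 0ℤ; 1ℤ)
import Data.Integer.DivMod as ℤ
import Data.Integer.Divisibility.Signed as ℤ
import Data.Integer.GCD as ℤ
import Data.Integer.Properties as ℤ
open import Data.List.Base as List using (List; []; _∷_; foldr)
open import Data.Nat.Base as ℕ using (ℕ; zero; suc; _!)
open import Data.Nat.Combinatorics using (k![n∸k]!∣n!)
import Data.Nat.Divisibility as ℕ
import Data.Nat.GeneralisedArithmetic as ℕ using (fold)
import Data.Nat.Properties as ℕ
open import Data.Product.Base using (∃; ∃-syntax; _×_; _,_)
open import Data.Rational.Base as ℚ using (ℚ; 0ℚ; 1ℚ; ∣_∣)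
import Data.Rational.Properties as ℚ
open import Data.Rational.Solver using (module +-*-Solver)
open import Data.Vec.Functional using (Vector)
open import Level using (0ℓ)
open import Relation.Binary.PropositionalEquality
open import Relation.Nullary.Negation using (¬_)

-- The list a₀ ∷ a₁ ∷ … ∷ aₘ ∷ [] stands for a₀ + a₁z + ⋯ + aₘzᵐ.  Trailing
-- zeros are allowed, so equality of polynomials is _≈ₚ_ and not _≡_.
Polynomial : Set
Polynomial = List ℤ

coeff : Polynomial → ℕ → ℤ
coeff []      _       = 0ℤ
coeff (a ∷ f) zero    = a
coeff (a ∷ f) (suc i) = coeff f i

infix 4 _≈ₚ_
_≈ₚ_ : Polynomial → Polynomial → Set
f ≈ₚ g = ∀ i → coeff f i ≡ coeff g i

infixl 6 _+ₚ_
_+ₚ_ : Polynomial → Polynomial → Polynomial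
[]      +ₚ g       = g
(a ∷ f) +ₚ []      = a ∷ f
(a ∷ f) +ₚ (b ∷ g) = a ℤ.+ b ∷ f +ₚ g

infixl 7 _*ₚ_
_*ₚ_ : Polynomial → Polynomial → Polynomial
[]      *ₚ g = []
(a ∷ f) *ₚ g = List.map (a ℤ.*_) g +ₚ (0ℤ ∷ f *ₚ g)

ℤ[z] : RawSemiring 0ℓ 0ℓ
ℤ[z] = record
  { Carrier = Polynomial
  ; _≈_     = _≈ₚ_
  ; _+_     = _+ₚ_
  ; _*_     = _*ₚ_
  ; 0#      = []
  ; 1#      = 1ℤ ∷ []
  }

-- Neither a unit nor a product of two non-units; this excludes 0 = 0 · 0.
open RawSemiringDefinitions ℤ[z] public using (Irreducible)

polynomial : ∀ {n} → Vector ℤ n → Polynomial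
polynomial = List.tabulate

content : Polynomial → ℤ
content = foldr ℤ.gcd 0ℤ

Primitive : Polynomial → Set
Primitive f = content f ≡ 1ℤ

eval : Polynomial → ℤ → ℤ
eval []      x = 0ℤ
eval (a ∷ f) x = a ℤ.+ x ℤ.* eval f x

-- weight k (b₀ ∷ b₁ ∷ …) = k b₀ ∷ (k + 1) b₁ ∷ …
weight : ℕ → Polynomial → Polynomial
weight k []      = []
weight k (b ∷ f) = + k ℤ.* b ∷ weight (suc k) f

derivative : Polynomial → Polynomial
derivative []      = []
derivative (a ∷ f) = weight 1 f

iteratedDerivative : ℕ → Polynomial → Polynomial
iteratedDerivative i f = ℕ.fold f derivative i

-- f⁽ⁱ⁾(x) / i!.  The integer division is exact: see dividedDerivative-exact.
dividedDerivative : ℕ → Polynomial → ℤ → ℤ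
dividedDerivative i f x = (eval (iteratedDerivative i f) x ℤ./ℕ (i !)) {{i ℕ.!≢0}}

coeff-weight : ∀ k f j → coeff (weight k f) j ≡ + (k ℕ.+ j) ℤ.* coeff f j
coeff-weight k []      j       = sym (ℤ.*-zeroʳ (+ (k ℕ.+ j)))
coeff-weight k (b ∷ f) zero    = cong (λ t → + t ℤ.* b) (sym (ℕ.+-identityʳ k))
coeff-weight k (b ∷ f) (suc j) =
  trans (coeff-weight (suc k) f j) (cong (λ t → + t ℤ.* coeff f j) (sym (ℕ.+-suc k j)))

coeff-derivative : ∀ f j → coeff (derivative f) j ≡ + suc j ℤ.* coeff f (suc j)
coeff-derivative []      j = sym (ℤ.*-zeroʳ (+ suc j))
coeff-derivative (a ∷ f) j = coeff-weight 1 f j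

coeff-iteratedDerivative : ∀ i f j →
  + (j !) ℤ.* coeff (iteratedDerivative i f) j ≡ + ((i ℕ.+ j) !) ℤ.* coeff f (i ℕ.+ j)
coeff-iteratedDerivative zero    f j = refl
coeff-iteratedDerivative (suc i) f j = begin
  + (j !) ℤ.* coeff (derivative g) j                ≡⟨ cong (+ (j !) ℤ.*_) (coeff-derivative g j) ⟩
  + (j !) ℤ.* (+ suc j ℤ.* coeff g (suc j))         ≡⟨ ℤ.*-assoc (+ (j !)) (+ suc j) _ ⟨
  + (j !) ℤ.* + suc j ℤ.* coeff g (suc j)           ≡⟨ cong (ℤ._* coeff g (suc j)) (ℤ.*-comm (+ (j !)) (+ suc j)) ⟩
  + suc j ℤ.* + (j !) ℤ.* coeff g (suc j)           ≡⟨ cong (ℤ._* coeff g (suc j)) (ℤ.pos-* (suc j) (j !)) ⟨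
  + (suc j !) ℤ.* coeff g (suc j)                   ≡⟨ coeff-iteratedDerivative i f (suc j) ⟩
  + ((i ℕ.+ suc j) !) ℤ.* coeff f (i ℕ.+ suc j)     ≡⟨ cong (λ t → + (t !) ℤ.* coeff f t) (ℕ.+-suc i j) ⟩
  + ((suc i ℕ.+ j) !) ℤ.* coeff f (suc i ℕ.+ j)     ∎
  where
  open ≡-Reasoning
  g : Polynomial
  g = iteratedDerivative i f

i!∣coeff : ∀ i f j → + (i !) ℤ.∣ coeff (iteratedDerivative i f) j
i!∣coeff i f j = ℤ.*-cancelˡ-∣ (+ (j !)) {{j ℕ.!≢0}} (subst₂ ℤ._∣_
  (trans (cong +_ (ℕ.*-comm (i !) (j !))) (ℤ.pos-* (j !) (i !)))
  (sym (coeff-iteratedDerivative i f j))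
  (ℤ.∣m⇒∣m*n {m = + ((i ℕ.+ j) !)} (coeff f (i ℕ.+ j)) (ℤ.∣ᵤ⇒∣ i!j!∣[i+j]!)))
  where
  i!j!∣[i+j]! : i ! ℕ.* j ! ℕ.∣ (i ℕ.+ j) !
  i!j!∣[i+j]! = subst (λ t → i ! ℕ.* t ! ℕ.∣ (i ℕ.+ j) !) (ℕ.m+n∸m≡n i j)
    (k![n∸k]!∣n! (ℕ.m≤m+n i j))

∣coeff⇒∣eval : ∀ {c} f x → (∀ j → c ℤ.∣ coeff f j) → c ℤ.∣ eval f x
∣coeff⇒∣eval []      x c∣f = c∣f 0
∣coeff⇒∣eval (a ∷ f) x c∣f =
  ℤ.∣m∣n⇒∣m+n (c∣f 0) (ℤ.∣n⇒∣m*n x (∣coeff⇒∣eval f x (λ j → c∣f (suc j))))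

dividedDerivative-exact : ∀ i f x →
  dividedDerivative i f x ℤ.* + (i !) ≡ eval (iteratedDerivative i f) x
dividedDerivative-exact i f x = begin
  dividedDerivative i f x ℤ.* + (i !)                ≡⟨ ℤ.+-identityˡ _ ⟨
  0ℤ ℤ.+ dividedDerivative i f x ℤ.* + (i !)         ≡⟨ cong (λ r → + r ℤ.+ dividedDerivative i f x ℤ.* + (i !)) r≡0 ⟨
  + r ℤ.+ dividedDerivative i f x ℤ.* + (i !)        ≡⟨ division ⟨
  y                                                  ∎
  where
  open ≡-Reasoning
  instance
    i!≢0 : ℕ.NonZero (i !)
    i!≢0 = i ℕ.!≢0
  y : ℤ
  y = eval (iteratedDerivative i f) x
  r : ℕ
  r = y ℤ.%ℕ (i !)
  division : y ≡ + r ℤ.+ dividedDerivative i f x ℤ.* + (i !)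
  division = ℤ.a≡a%ℕn+[a/ℕn]*n y (i !)
  i!∣r : + (i !) ℤ.∣ + r
  i!∣r = ℤ.∣m+n∣n⇒∣m (subst (+ (i !) ℤ.∣_) division
    (∣coeff⇒∣eval (iteratedDerivative i f) x (i!∣coeff i f)))
    (ℤ.∣n⇒∣m*n (dividedDerivative i f x) ℤ.∣-refl)
  r≡0 : r ≡ 0
  r≡0 = trans (sym (ℕ.m<n⇒m%n≡m (ℤ.n%ℕd<d y (i !)))) (ℕ.n∣m⇒m%n≡0 r (i !) (ℤ.∣⇒∣ᵤ i!∣r))
    where import Data.Nat.DivMod as ℕ

IsCauchy : (ℕ → ℚ) → Set
IsCauchy s = ∀ ε → 0ℚ ℚ.< ε →
  ∃[ N ] ∀ m n → N ℕ.≤ m → N ℕ.≤ n → ∣ s m ℚ.- s n ∣ ℚ.< ε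

-- Cauchy sequences of rationals; equality of reals is _≃ℝ_ and not _≡_.
record ℝ : Set where
  constructor mkℝ
  field
    seq    : ℕ → ℚ
    cauchy : IsCauchy seq

open ℝ public

infix 4 _≃ℝ_ _<ℝ_ _≤ℝ_

_≃ℝ_ : ℝ → ℝ → Set
x ≃ℝ y = ∀ ε → 0ℚ ℚ.< ε → ∃[ N ] ∀ n → N ℕ.≤ n → ∣ seq x n ℚ.- seq y n ∣ ℚ.< ε

_<ℝ_ : ℝ → ℝ → Set
x <ℝ y = ∃[ ε ] 0ℚ ℚ.< ε × (∃[ N ] ∀ n → N ℕ.≤ n → seq x n ℚ.+ ε ℚ.≤ seq y n)

_≤ℝ_ : ℝ → ℝ → Set
x ≤ℝ y = ¬ (y <ℝ x)

fromℚ : ℚ → ℝ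
fromℚ q = mkℝ (λ _ → q) λ ε 0<ε → 0 , λ _ _ _ _ →
  subst (λ t → ∣ t ∣ ℚ.< ε) (sym (ℚ.+-inverseʳ q)) 0<ε

fromℕ : ℕ → ℝ
fromℕ n = fromℚ (+ n ℚ./ 1)

0ℝ 1ℝ : ℝ
0ℝ = fromℚ 0ℚ
1ℝ = fromℚ 1ℚ

private

  0<p*q : ∀ {p q} → 0ℚ ℚ.< p → 0ℚ ℚ.< q → 0ℚ ℚ.< p ℚ.* q
  0<p*q {p} {q} 0<p 0<q = subst (ℚ._< p ℚ.* q) (ℚ.*-zeroʳ p)
    (ℚ.*-monoʳ-<-pos p {{ℚ.positive 0<p}} 0<q)

  EventuallyBounded : (ℕ → ℚ) → Set
  EventuallyBounded s = ∃[ B ] 0ℚ ℚ.< B × (∃[ N ] ∀ n → N ℕ.≤ n → ∣ s n ∣ ℚ.≤ B)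

  cauchy⇒bounded : ∀ {s} → IsCauchy s → EventuallyBounded s
  cauchy⇒bounded {s} c with c 1ℚ (ℚ.positive⁻¹ 1ℚ)
  ... | N , close = 1ℚ ℚ.+ ∣ s N ∣ , 0<B , N , λ n N≤n → begin
    ∣ s n ∣                          ≡⟨ cong ∣_∣ (split (s n) (s N)) ⟩
    ∣ (s n ℚ.- s N) ℚ.+ s N ∣        ≤⟨ ℚ.∣p+q∣≤∣p∣+∣q∣ (s n ℚ.- s N) (s N) ⟩
    ∣ s n ℚ.- s N ∣ ℚ.+ ∣ s N ∣      ≤⟨ ℚ.+-monoˡ-≤ ∣ s N ∣ (ℚ.<⇒≤ (close n N N≤n ℕ.≤-refl)) ⟩
    1ℚ ℚ.+ ∣ s N ∣                   ∎
    where
    open ℚ.≤-Reasoning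
    split : ∀ a b → a ≡ (a ℚ.- b) ℚ.+ b
    split = solve 2 (λ a b → a := (a :- b) :+ b) refl
      where open +-*-Solver
    0<B : 0ℚ ℚ.< 1ℚ ℚ.+ ∣ s N ∣
    0<B = ℚ.+-mono-<-≤ (ℚ.positive⁻¹ 1ℚ) (ℚ.0≤∣p∣ (s N))

  +-cauchy : ∀ {s t} → IsCauchy s → IsCauchy t → IsCauchy (λ n → s n ℚ.+ t n)
  +-cauchy {s} {t} cs ct ε 0<ε
    with cs (ℚ.½ ℚ.* ε) (0<p*q (ℚ.positive⁻¹ ℚ.½) 0<ε)
       | ct (ℚ.½ ℚ.* ε) (0<p*q (ℚ.positive⁻¹ ℚ.½) 0<ε)
  ... | M , s-close | N , t-close = M ℕ.⊔ N , λ m n h k → begin-strict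
    ∣ (s m ℚ.+ t m) ℚ.- (s n ℚ.+ t n) ∣          ≡⟨ cong ∣_∣ (split (s m) (t m) (s n) (t n)) ⟩
    ∣ (s m ℚ.- s n) ℚ.+ (t m ℚ.- t n) ∣          ≤⟨ ℚ.∣p+q∣≤∣p∣+∣q∣ (s m ℚ.- s n) (t m ℚ.- t n) ⟩
    ∣ s m ℚ.- s n ∣ ℚ.+ ∣ t m ℚ.- t n ∣          <⟨ ℚ.+-mono-< (s-close m n (ℕ.m⊔n≤o⇒m≤o M N h) (ℕ.m⊔n≤o⇒m≤o M N k)) (t-close m n (ℕ.m⊔n≤o⇒n≤o M N h) (ℕ.m⊔n≤o⇒n≤o M N k)) ⟩
    ℚ.½ ℚ.* ε ℚ.+ ℚ.½ ℚ.* ε                      ≡⟨ ℚ.*-distribʳ-+ ε ℚ.½ ℚ.½ ⟨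
    1ℚ ℚ.* ε                                     ≡⟨ ℚ.*-identityˡ ε ⟩
    ε                                            ∎
    where
    open ℚ.≤-Reasoning
    split : ∀ a b c d → (a ℚ.+ b) ℚ.- (c ℚ.+ d) ≡ (a ℚ.- c) ℚ.+ (b ℚ.- d)
    split = solve 4 (λ a b c d → (a :+ b) :- (c :+ d) := (a :- c) :+ (b :- d)) refl
      where open +-*-Solver

  telescope : ∀ x y z → x ℚ.- z ≡ (x ℚ.- y) ℚ.+ (y ℚ.- z)
  telescope = solve 3 (λ x y z → x :- z := (x :- y) :+ (y :- z)) refl
    where open +-*-Solver

  *-distribˡ-- : ∀ x y z → x ℚ.* (y ℚ.- z) ≡ x ℚ.* y ℚ.- x ℚ.* z
  *-distribˡ-- x y z = trans (ℚ.*-distribˡ-+ x y (ℚ.- z))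
    (cong (x ℚ.* y ℚ.+_) (sym (ℚ.neg-distribʳ-* x z)))

  *-difference : ∀ a b c d → a ℚ.* b ℚ.- c ℚ.* d ≡ a ℚ.* (b ℚ.- d) ℚ.+ d ℚ.* (a ℚ.- c)
  *-difference a b c d = begin
    a ℚ.* b ℚ.- c ℚ.* d                                  ≡⟨ telescope (a ℚ.* b) (a ℚ.* d) (c ℚ.* d) ⟩
    (a ℚ.* b ℚ.- a ℚ.* d) ℚ.+ (a ℚ.* d ℚ.- c ℚ.* d)      ≡⟨ cong₂ (λ u v → (a ℚ.* b ℚ.- a ℚ.* d) ℚ.+ (u ℚ.- v)) (ℚ.*-comm a d) (ℚ.*-comm c d) ⟩
    (a ℚ.* b ℚ.- a ℚ.* d) ℚ.+ (d ℚ.* a ℚ.- d ℚ.* c)      ≡⟨ cong₂ ℚ._+_ (*-distribˡ-- a b d) (*-distribˡ-- d a c) ⟨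
    a ℚ.* (b ℚ.- d) ℚ.+ d ℚ.* (a ℚ.- c)                  ∎
    where open ≡-Reasoning

  *-bound : ∀ u v {B δ} → 0ℚ ℚ.< B → ∣ u ∣ ℚ.≤ B → ∣ v ∣ ℚ.< δ → ∣ u ℚ.* v ∣ ℚ.< B ℚ.* δ
  *-bound u v {B} {δ} 0<B u≤B v<δ = begin-strict
    ∣ u ℚ.* v ∣        ≡⟨ ℚ.∣p*q∣≡∣p∣*∣q∣ u v ⟩
    ∣ u ∣ ℚ.* ∣ v ∣    ≤⟨ ℚ.*-monoʳ-≤-nonNeg ∣ v ∣ {{ℚ.nonNegative (ℚ.0≤∣p∣ v)}} u≤B ⟩
    B ℚ.* ∣ v ∣        <⟨ ℚ.*-monoʳ-<-pos B {{ℚ.positive 0<B}} v<δ ⟩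
    B ℚ.* δ            ∎
    where open ℚ.≤-Reasoning

  *-close : ∀ a b c d {B C δ} → 0ℚ ℚ.< B → 0ℚ ℚ.< C → ∣ a ∣ ℚ.≤ B → ∣ d ∣ ℚ.≤ C →
    ∣ a ℚ.- c ∣ ℚ.< δ → ∣ b ℚ.- d ∣ ℚ.< δ → ∣ a ℚ.* b ℚ.- c ℚ.* d ∣ ℚ.< (B ℚ.+ C) ℚ.* δ
  *-close a b c d {B} {C} {δ} 0<B 0<C a≤B d≤C a-c<δ b-d<δ = begin-strict
    ∣ a ℚ.* b ℚ.- c ℚ.* d ∣                        ≡⟨ cong ∣_∣ (*-difference a b c d) ⟩
    ∣ a ℚ.* (b ℚ.- d) ℚ.+ d ℚ.* (a ℚ.- c) ∣        ≤⟨ ℚ.∣p+q∣≤∣p∣+∣q∣ (a ℚ.* (b ℚ.- d)) (d ℚ.* (a ℚ.- c)) ⟩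
    ∣ a ℚ.* (b ℚ.- d) ∣ ℚ.+ ∣ d ℚ.* (a ℚ.- c) ∣    <⟨ ℚ.+-mono-< (*-bound a (b ℚ.- d) 0<B a≤B b-d<δ) (*-bound d (a ℚ.- c) 0<C d≤C a-c<δ) ⟩
    B ℚ.* δ ℚ.+ C ℚ.* δ                            ≡⟨ ℚ.*-distribʳ-+ δ B C ⟨
    (B ℚ.+ C) ℚ.* δ                                ∎
    where open ℚ.≤-Reasoning

  divide : ∀ K ε → 0ℚ ℚ.< K → 0ℚ ℚ.< ε → ∃[ δ ] 0ℚ ℚ.< δ × K ℚ.* δ ≡ ε
  divide K ε 0<K 0<ε = (ℚ.1/ K) ℚ.* ε
    , 0<p*q (ℚ.positive⁻¹ (ℚ.1/ K) {{ℚ.1/pos⇒pos K}}) 0<ε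
    , (begin
      K ℚ.* ((ℚ.1/ K) ℚ.* ε)    ≡⟨ ℚ.*-assoc K (ℚ.1/ K) ε ⟨
      (K ℚ.* ℚ.1/ K) ℚ.* ε      ≡⟨ cong (ℚ._* ε) (ℚ.*-inverseʳ K) ⟩
      1ℚ ℚ.* ε                  ≡⟨ ℚ.*-identityˡ ε ⟩
      ε                         ∎)
    where
    open ≡-Reasoning
    instance
      K⁺ : ℚ.Positive K
      K⁺ = ℚ.positive 0<K
      K≢0 : ℚ.NonZero K
      K≢0 = ℚ.pos⇒nonZero K

  *-cauchy : ∀ {s t} → IsCauchy s → IsCauchy t → IsCauchy (λ n → s n ℚ.* t n)
  *-cauchy {s} {t} cs ct ε 0<ε =
    let B , 0<B , M₁ , s≤B = cauchy⇒bounded {s} cs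
        C , 0<C , N₁ , t≤C = cauchy⇒bounded {t} ct
        δ , 0<δ , Kδ≡ε     = divide (B ℚ.+ C) ε (ℚ.+-mono-< 0<B 0<C) 0<ε
        M₂ , s-close       = cs δ 0<δ
        N₂ , t-close       = ct δ 0<δ
        M                  = M₁ ℕ.⊔ M₂
        N                  = N₁ ℕ.⊔ N₂
    in M ℕ.⊔ N , λ m n h k →
      let M≤m = ℕ.m⊔n≤o⇒m≤o M N h
          N≤m = ℕ.m⊔n≤o⇒n≤o M N h
          M≤n = ℕ.m⊔n≤o⇒m≤o M N k
          N≤n = ℕ.m⊔n≤o⇒n≤o M N k
      in subst (∣ s m ℚ.* t m ℚ.- s n ℚ.* t n ∣ ℚ.<_) Kδ≡ε
        (*-close (s m) (t m) (s n) (t n) 0<B 0<C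
          (s≤B m (ℕ.m⊔n≤o⇒m≤o M₁ M₂ M≤m))
          (t≤C n (ℕ.m⊔n≤o⇒m≤o N₁ N₂ N≤n))
          (s-close m n (ℕ.m⊔n≤o⇒n≤o M₁ M₂ M≤m) (ℕ.m⊔n≤o⇒n≤o M₁ M₂ M≤n))
          (t-close m n (ℕ.m⊔n≤o⇒n≤o N₁ N₂ N≤m) (ℕ.m⊔n≤o⇒n≤o N₁ N₂ N≤n)))

infixl 6 _+ℝ_
_+ℝ_ : ℝ → ℝ → ℝ
x +ℝ y = mkℝ (λ n → seq x n ℚ.+ seq y n) (+-cauchy {seq x} {seq y} (cauchy x) (cauchy y))

infixl 7 _*ℝ_
_*ℝ_ : ℝ → ℝ → ℝ
x *ℝ y = mkℝ (λ n → seq x n ℚ.* seq y n) (*-cauchy {seq x} {seq y} (cauchy x) (cauchy y))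

ℝ-rawSemiring : RawSemiring 0ℓ 0ℓ
ℝ-rawSemiring = record
  { Carrier = ℝ
  ; _≈_     = _≃ℝ_
  ; _+_     = _+ℝ_
  ; _*_     = _*ℝ_
  ; 0#      = 0ℝ
  ; 1#      = 1ℝ
  }

open RawSemiringDefinitions ℝ-rawSemiring public using () renaming (_^_ to infixr 8 _^ℝ_; sum to sumℝ)

{-# OPTIONS --safe #-}
-- Suppose f = g h with neither factor constant.
--
-- If k = 1, then p² ∤ f(n), so p does not divide both g(n) and h(n).  If k > 1, the substitution z ↦ n + z turns
-- f⁽ⁱ⁾(n)/i! into coefficients, and the p-adic Newton polygon of f(n + z) between the indices 0 and ℓ is the segment
-- from (0 , k) to (ℓ , 0), which has no interior lattice points.  Hence again p does not divide both g(n) and h(n).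
-- The factor whose value is prime to p, say h, has |h(n)| ≤ d.
--
-- The roots of f lie in |z| < α, which would give |h(n)| > (n − α)^(deg h) ≥ d.  Roots are avoided as follows.  The
-- dominance of aₘ persists from α to the integer N = n − d ≥ α.  On the integer sequences s that satisfy the
-- recurrence with characteristic polynomial h, hence also the one of f, it makes the shift S an operator of norm at
-- most N for max |sᵢ| N⁻ⁱ.  If q = (h − h(n)) / (z − n), then (n − S) q(S) = h(n), so |h(n)| ≤ d = n − N makes the
-- integral operator q(S) strictly decrease this norm.  By infinite descent s = 0, although nonzero s exist.
module Submission where

open import Defs
open import Algebra.Bundles using (RawSemiring)
import Algebra.Definitions.RawMagma as RawMagmaDefinitions
import Algebra.Definitions.RawMonoid as RawMonoidDefinitions
import Algebra.Definitions.RawSemiring as RawSemiringDefinitions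
open import Data.Empty using (⊥; ⊥-elim)
open import Data.Fin.Base as Fin using (Fin; toℕ; inject₁)
import Data.Fin.Properties as Fin
open import Data.Integer.Base as ℤ using (ℤ; +_; ∣_∣; 0ℤ; 1ℤ)
open import Data.Integer.Divisibility as ℤ using ()
import Data.Integer.Divisibility.Signed as Signed
import Data.Integer.GCD as ℤ
import Data.Integer.Properties as ℤ
open import Data.Integer.Tactic.RingSolver using (solve-∀)
open import Data.List.Base as List using ([]; _∷_; _++_; length)
import Data.List.Properties as List
open import Data.Nat.Base as ℕ using (ℕ; zero; suc; _≤_; _<_; z≤n; s≤s; _!)
open import Data.Nat.Coprimality as Coprimality using (Coprime)
open import Data.Nat.Divisibility as ℕ using ()
open import Data.Nat.GCD using (gcd)
open import Data.Nat.Primality using (Prime; euclidsLemma; prime⇒irreducible; prime⇒nonTrivial; prime⇒nonZero)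
import Data.Nat.Properties as ℕ
open import Data.Nat.Solver using (module +-*-Solver)
open import Data.Product.Base using (∃-syntax; _×_; _,_; proj₁; proj₂)
open import Data.Rational.Base as ℚ using (ℚ; 0ℚ; 1ℚ)
import Data.Rational.Properties as ℚ
import Data.Rational.Solver as ℚ
open import Data.Rational.Unnormalised.Base as ℚᵘ using (mkℚᵘ)
import Data.Rational.Unnormalised.Properties as ℚᵘ
open import Data.Sum.Base using (_⊎_; inj₁; inj₂; [_,_]′)
open import Data.Vec.Functional using (Vector)
open import Function.Base using (_∘_)
open import Relation.Binary.Definitions using (tri<; tri≈; tri>)
open import Relation.Binary.PropositionalEquality
open import Relation.Nullary.Decidable using (yes; no)
open import Relation.Nullary.Negation using (¬_; contradiction)

open RawMagmaDefinitions (RawSemiring.*-rawMagma ℤ[z]) using (_∣ʳ_)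
open RawMonoidDefinitions ℕ.+-0-rawMonoid using () renaming (sum to sumℕ)
open RawSemiringDefinitions ℚ.+-*-rawSemiring using (_^_) renaming (sum to sumℚ)
open RawSemiringDefinitions ℤ[z] using () renaming (_∣_ to infix 4 _∣ₚ_)

-- Linear recurrences

infixl 7 _∙_
-- With S the shift of sequences, `f ∙ s` is the zeroth term of f(S) s; applied to `s` shifted by
-- `j` it is the j-th term.
_∙_ : Polynomial → (ℕ → ℤ) → ℤ
[]      ∙ s = 0ℤ
(a ∷ f) ∙ s = a ℤ.* s 0 ℤ.+ f ∙ (s ∘ suc)

∙-congʳ : ∀ f {s t} → (∀ i → i < length f → s i ≡ t i) → f ∙ s ≡ f ∙ t
∙-congʳ []      s≗t = refl
∙-congʳ (a ∷ f) s≗t =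
  cong₂ (λ x y → a ℤ.* x ℤ.+ y) (s≗t 0 (s≤s z≤n)) (∙-congʳ f (λ i i<f → s≗t (suc i) (s≤s i<f)))

∙-zeroʳ : ∀ f {s} → (∀ i → i < length f → s i ≡ 0ℤ) → f ∙ s ≡ 0ℤ
∙-zeroʳ []      s≗0 = refl
∙-zeroʳ (a ∷ f) {s} s≗0
  rewrite s≗0 0 (s≤s z≤n) | ∙-zeroʳ f {s ∘ suc} (λ i i<f → s≗0 (suc i) (s≤s i<f)) | ℤ.*-zeroʳ a = refl

∙-zeroˡ : ∀ f s → (∀ i → coeff f i ≡ 0ℤ) → f ∙ s ≡ 0ℤ
∙-zeroˡ []      s f≈0 = refl
∙-zeroˡ (a ∷ f) s f≈0 rewrite f≈0 0 | ∙-zeroˡ f (s ∘ suc) (f≈0 ∘ suc) = refl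

∙-congˡ : ∀ f g s → f ≈ₚ g → f ∙ s ≡ g ∙ s
∙-congˡ []      g       s f≈g = sym (∙-zeroˡ g s (sym ∘ f≈g))
∙-congˡ (a ∷ f) []      s f≈g = ∙-zeroˡ (a ∷ f) s f≈g
∙-congˡ (a ∷ f) (b ∷ g) s f≈g =
  cong₂ (λ x y → x ℤ.* s 0 ℤ.+ y) (f≈g 0) (∙-congˡ f g (s ∘ suc) (f≈g ∘ suc))

∙-distribʳ-+ₚ : ∀ f g s → (f +ₚ g) ∙ s ≡ f ∙ s ℤ.+ g ∙ s
∙-distribʳ-+ₚ []      g       s = sym (ℤ.+-identityˡ _)
∙-distribʳ-+ₚ (a ∷ f) []      s = sym (ℤ.+-identityʳ _)
∙-distribʳ-+ₚ (a ∷ f) (b ∷ g) s rewrite ∙-distribʳ-+ₚ f g (s ∘ suc) =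
  interchange a b (s 0) (f ∙ (s ∘ suc)) (g ∙ (s ∘ suc))
  where
  interchange : ∀ a b x u v →
    (a ℤ.+ b) ℤ.* x ℤ.+ (u ℤ.+ v) ≡ (a ℤ.* x ℤ.+ u) ℤ.+ (b ℤ.* x ℤ.+ v)
  interchange = solve-∀

∙-map-* : ∀ c f s → List.map (c ℤ.*_) f ∙ s ≡ c ℤ.* (f ∙ s)
∙-map-* c []      s = sym (ℤ.*-zeroʳ c)
∙-map-* c (a ∷ f) s rewrite ∙-map-* c f (s ∘ suc) = factor c a (s 0) (f ∙ (s ∘ suc))
  where
  factor : ∀ c a x u → c ℤ.* a ℤ.* x ℤ.+ c ℤ.* u ≡ c ℤ.* (a ℤ.* x ℤ.+ u)
  factor = solve-∀

∙-linearʳ : ∀ f x y s t → f ∙ (λ i → x ℤ.* s i ℤ.+ y ℤ.* t i) ≡ x ℤ.* (f ∙ s) ℤ.+ y ℤ.* (f ∙ t)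
∙-linearʳ []      x y s t = sym (cong₂ ℤ._+_ (ℤ.*-zeroʳ x) (ℤ.*-zeroʳ y))
∙-linearʳ (a ∷ f) x y s t rewrite ∙-linearʳ f x y (s ∘ suc) (t ∘ suc) =
  collect a x y (s 0) (t 0) (f ∙ (s ∘ suc)) (f ∙ (t ∘ suc))
  where
  collect : ∀ a x y s t u v →
    a ℤ.* (x ℤ.* s ℤ.+ y ℤ.* t) ℤ.+ (x ℤ.* u ℤ.+ y ℤ.* v) ≡
    x ℤ.* (a ℤ.* s ℤ.+ u) ℤ.+ y ℤ.* (a ℤ.* t ℤ.+ v)
  collect = solve-∀

-- The operator (f g)(S) is the composite of f(S) and g(S), read off at the zeroth term.
∙-*ₚ : ∀ f g s → (f *ₚ g) ∙ s ≡ f ∙ (λ j → g ∙ (λ i → s (j ℕ.+ i)))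
∙-*ₚ []      g s = refl
∙-*ₚ (a ∷ f) g s = begin
  (List.map (a ℤ.*_) g +ₚ (0ℤ ∷ f *ₚ g)) ∙ s
    ≡⟨ ∙-distribʳ-+ₚ (List.map (a ℤ.*_) g) (0ℤ ∷ f *ₚ g) s ⟩
  List.map (a ℤ.*_) g ∙ s ℤ.+ (0ℤ ℤ.+ (f *ₚ g) ∙ (s ∘ suc))
    ≡⟨ cong₂ ℤ._+_ (∙-map-* a g s) (trans (ℤ.+-identityˡ _) (∙-*ₚ f g (s ∘ suc))) ⟩
  a ℤ.* (g ∙ s) ℤ.+ f ∙ (λ j → g ∙ (λ i → s (suc j ℕ.+ i))) ∎
  where open ≡-Reasoning

∙-swap : ∀ f g (u : ℕ → ℕ → ℤ) → f ∙ (λ j → g ∙ u j) ≡ g ∙ (λ i → f ∙ (λ j → u j i))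
∙-swap []      g u = sym (∙-zeroʳ g (λ _ _ → refl))
∙-swap (a ∷ f) g u = begin
  a ℤ.* (g ∙ u 0) ℤ.+ f ∙ (λ j → g ∙ u (suc j))
    ≡⟨ cong (λ v → a ℤ.* (g ∙ u 0) ℤ.+ v) (trans (∙-swap f g (u ∘ suc)) (sym (ℤ.*-identityˡ _))) ⟩
  a ℤ.* (g ∙ u 0) ℤ.+ 1ℤ ℤ.* (g ∙ (λ i → f ∙ (λ j → u (suc j) i)))
    ≡⟨ ∙-linearʳ g a 1ℤ (u 0) (λ i → f ∙ (λ j → u (suc j) i)) ⟨
  g ∙ (λ i → a ℤ.* u 0 i ℤ.+ 1ℤ ℤ.* (f ∙ (λ j → u (suc j) i)))
    ≡⟨ ∙-congʳ g (λ i _ → cong (λ v → a ℤ.* u 0 i ℤ.+ v) (ℤ.*-identityˡ _)) ⟩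
  g ∙ (λ i → a ℤ.* u 0 i ℤ.+ f ∙ (λ j → u (suc j) i)) ∎
  where open ≡-Reasoning

-- Only J instances of the recurrence: h need not be monic, so a nonzero integer solution of all of them may not exist.
Solves : ℕ → Polynomial → (ℕ → ℤ) → Set
Solves J h s = ∀ j → j < J → h ∙ (λ i → s (j ℕ.+ i)) ≡ 0ℤ

-- `g` reads only the first `length g` terms of h(S) s, so that many instances suffice.
solves-*ₚˡ : ∀ f g h {s} → f ≈ₚ g *ₚ h → Solves (length g) h s → f ∙ s ≡ 0ℤ
solves-*ₚˡ f g h {s} f≈gh sol =
  trans (∙-congˡ f (g *ₚ h) s f≈gh) (trans (∙-*ₚ g h s) (∙-zeroʳ g sol))

-- The same for the other factor: g(S) and h(S) commute, because `∙-swap` exchanges the two finite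
-- sums.
solves-*ₚʳ : ∀ f g h {s} → f ≈ₚ g *ₚ h → Solves (length h) g s → f ∙ s ≡ 0ℤ
solves-*ₚʳ f g h {s} f≈gh sol = begin
  f ∙ s                                         ≡⟨ ∙-congˡ f (g *ₚ h) s f≈gh ⟩
  (g *ₚ h) ∙ s                                  ≡⟨ ∙-*ₚ g h s ⟩
  g ∙ (λ j → h ∙ (λ i → s (j ℕ.+ i)))           ≡⟨ ∙-swap g h (λ j i → s (j ℕ.+ i)) ⟩
  h ∙ (λ i → g ∙ (λ j → s (j ℕ.+ i)))           ≡⟨ ∙-congʳ h (λ i _ → ∙-congʳ g (λ j _ → cong s (ℕ.+-comm j i))) ⟩
  h ∙ (λ i → g ∙ (λ j → s (i ℕ.+ j)))           ≡⟨ ∙-zeroʳ h sol ⟩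
  0ℤ                                            ∎
  where open ≡-Reasoning

solves-cong : ∀ {J} h h′ s → h ≈ₚ h′ → Solves J h s → Solves J h′ s
solves-cong h h′ s h≈h′ sol j j<J = trans (sym (∙-congˡ h h′ (λ i → s (j ℕ.+ i)) h≈h′)) (sol j j<J)

∙-∷ʳ : ∀ f b s → (f ++ b ∷ []) ∙ s ≡ f ∙ s ℤ.+ b ℤ.* s (length f)
∙-∷ʳ []      b s = ℤ.+-comm (b ℤ.* s 0) 0ℤ
∙-∷ʳ (a ∷ f) b s rewrite ∙-∷ʳ f b (s ∘ suc) = sym (ℤ.+-assoc (a ℤ.* s 0) _ _)

-- Each further instance is solved for one new term through the leading coefficient `b`. The shape
-- `a ∷ f ++ b ∷ []` keeps index 0 below every new term, so `s 0` is only ever multiplied by `b` and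
-- stays nonzero.
∃-solution : ∀ a f b → b ≢ 0ℤ → ∀ J → ∃[ s ] Solves J (a ∷ f ++ b ∷ []) s × s 0 ≢ 0ℤ
∃-solution a f b b≢0 zero    = (λ _ → 1ℤ) , (λ _ ()) , λ ()
∃-solution a f b b≢0 (suc J) with ∃-solution a f b b≢0 J
... | s , sol , s₀≢0 = t , t-sol , t₀≢0
  where
  r = length (a ∷ f)
  -- The earlier terms get multiplied by `b`, so this value solves instance `J` without a division.
  last : ℤ
  last = ℤ.- ((a ∷ f) ∙ (λ i → s (J ℕ.+ i)))
  -- Scaling by b keeps the next term integral.
  t : ℕ → ℤ
  t i with i ℕ.<? J ℕ.+ r
  ... | yes _ = b ℤ.* s i
  ... | no  _ = last
  t-old : ∀ {i} → i < J ℕ.+ r → t i ≡ b ℤ.* s i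
  t-old {i} i< with i ℕ.<? J ℕ.+ r
  ... | yes _  = refl
  ... | no  i≮ = contradiction i< i≮
  t-new : t (J ℕ.+ r) ≡ last
  t-new with J ℕ.+ r ℕ.<? J ℕ.+ r
  ... | yes r<r = contradiction r<r (ℕ.<-irrefl refl)
  ... | no  _   = refl
  t₀≢0 : t 0 ≢ 0ℤ
  t₀≢0 t₀≡0 with ℤ.i*j≡0⇒i≡0∨j≡0 b (trans (sym (t-old (ℕ.≤-trans (s≤s z≤n) (ℕ.m≤n+m r J)))) t₀≡0)
  ... | inj₁ b≡0  = b≢0 b≡0
  ... | inj₂ s₀≡0 = s₀≢0 s₀≡0
  scale : ∀ u j → (∀ i → i < length u → j ℕ.+ i < J ℕ.+ r) →
    u ∙ (λ i → t (j ℕ.+ i)) ≡ b ℤ.* (u ∙ (λ i → s (j ℕ.+ i)))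
  scale u j old = begin
    u ∙ (λ i → t (j ℕ.+ i))
      ≡⟨ ∙-congʳ u (λ i i<u → trans (t-old (old i i<u)) (sym (ℤ.+-identityʳ _))) ⟩
    u ∙ (λ i → b ℤ.* s (j ℕ.+ i) ℤ.+ 0ℤ ℤ.* 0ℤ)           ≡⟨ ∙-linearʳ u b 0ℤ (λ i → s (j ℕ.+ i)) (λ _ → 0ℤ) ⟩
    b ℤ.* (u ∙ (λ i → s (j ℕ.+ i))) ℤ.+ 0ℤ                ≡⟨ ℤ.+-identityʳ _ ⟩
    b ℤ.* (u ∙ (λ i → s (j ℕ.+ i)))                       ∎
    where open ≡-Reasoning
  t-sol : Solves (suc J) (a ∷ f ++ b ∷ []) t
  t-sol j (s≤s j≤J) with ℕ.m≤n⇒m<n∨m≡n j≤J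
  ... | inj₁ j<J = trans (scale (a ∷ f ++ b ∷ []) j old) (trans (cong (b ℤ.*_) (sol j j<J)) (ℤ.*-zeroʳ b))
    where
    old : ∀ i → i < length (a ∷ f ++ b ∷ []) → j ℕ.+ i < J ℕ.+ r
    old i i< = ℕ.+-mono-<-≤ j<J (ℕ.≤-pred (subst (i <_) (trans (List.length-++ (a ∷ f)) (ℕ.+-comm r 1)) i<))
  ... | inj₂ refl = begin
    (a ∷ f ++ b ∷ []) ∙ (λ i → t (J ℕ.+ i))             ≡⟨ ∙-∷ʳ (a ∷ f) b (λ i → t (J ℕ.+ i)) ⟩
    (a ∷ f) ∙ (λ i → t (J ℕ.+ i)) ℤ.+ b ℤ.* t (J ℕ.+ r)
      ≡⟨ cong₂ (λ x y → x ℤ.+ b ℤ.* y) (scale (a ∷ f) J (λ i → ℕ.+-monoʳ-< J)) t-new ⟩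
    b ℤ.* x ℤ.+ b ℤ.* (ℤ.- x)                           ≡⟨ cancel b x ⟩
    0ℤ                                                  ∎
    where
    open ≡-Reasoning
    x = (a ∷ f) ∙ (λ i → s (J ℕ.+ i))
    cancel : ∀ b x → b ℤ.* x ℤ.+ b ℤ.* (ℤ.- x) ≡ 0ℤ
    cancel = solve-∀

-- f = f(x) + (z − x) · syntheticQuotient f x
syntheticQuotient : Polynomial → ℤ → Polynomial
syntheticQuotient []      x = []
syntheticQuotient (a ∷ f) x = eval f x ∷ syntheticQuotient f x

-- The hypothesis says (x - S) t = c s. Inserting f(S) = f(x) - (x - S) q(S) gives f(S) t = f(x) t -
-- c q(S) s. The scalar `c` is independent of `f`, because the induction passes to the tail of `f`,
-- whose value at `x` is another one.
∙-syntheticQuotient : ∀ f x c {s t} → (∀ i → t (suc i) ≡ x ℤ.* t i ℤ.- c ℤ.* s i) →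
  f ∙ t ≡ eval f x ℤ.* t 0 ℤ.- c ℤ.* (syntheticQuotient f x ∙ s)
∙-syntheticQuotient []      x c {s} {t} rec = vanish c (t 0)
  where
  vanish : ∀ c y → 0ℤ ≡ 0ℤ ℤ.* y ℤ.- c ℤ.* 0ℤ
  vanish = solve-∀
∙-syntheticQuotient (a ∷ f) x c {s} {t} rec
  rewrite ∙-syntheticQuotient f x c {s ∘ suc} {t ∘ suc} (rec ∘ suc) | rec 0 =
  horner a x c (eval f x) (t 0) (s 0) (syntheticQuotient f x ∙ (s ∘ suc))
  where
  horner : ∀ a x c y t s q →
    a ℤ.* t ℤ.+ (y ℤ.* (x ℤ.* t ℤ.- c ℤ.* s) ℤ.- c ℤ.* q) ≡
    (a ℤ.+ x ℤ.* y) ℤ.* t ℤ.- c ℤ.* (y ℤ.* s ℤ.+ q)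
  horner = solve-∀

-- With S the shift of sequences, t = descend h x s satisfies (x − S) t = h(x) s.
descend : Polynomial → ℤ → (ℕ → ℤ) → ℕ → ℤ
descend h x s zero    = syntheticQuotient h x ∙ s
descend h x s (suc i) = x ℤ.* descend h x s i ℤ.- eval h x ℤ.* s i

-- For j = 0 the starting value of `descend` makes the two terms of `∙-syntheticQuotient` cancel.
-- Each later instance is `x` times the preceding one for `t` minus h(x) times the preceding one for
-- `s`.
descend-solves : ∀ {J} h x {s} → Solves J h s → Solves J h (descend h x s)
descend-solves h x {s} sol zero    0<J =
  trans (∙-syntheticQuotient h x (eval h x) {s} {descend h x s} (λ _ → refl)) (ℤ.+-inverseʳ (eval h x ℤ.* (syntheticQuotient h x ∙ s)))
descend-solves h x {s} sol (suc j) j<J = begin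
  h ∙ (λ i → x ℤ.* t (j ℕ.+ i) ℤ.- c ℤ.* s (j ℕ.+ i))
    ≡⟨ ∙-congʳ h (λ i _ → cong (λ v → x ℤ.* t (j ℕ.+ i) ℤ.+ v) (ℤ.neg-distribˡ-* c (s (j ℕ.+ i)))) ⟩
  h ∙ (λ i → x ℤ.* t (j ℕ.+ i) ℤ.+ (ℤ.- c) ℤ.* s (j ℕ.+ i))
    ≡⟨ ∙-linearʳ h x (ℤ.- c) (λ i → t (j ℕ.+ i)) (λ i → s (j ℕ.+ i)) ⟩
  x ℤ.* (h ∙ (λ i → t (j ℕ.+ i))) ℤ.+ (ℤ.- c) ℤ.* (h ∙ (λ i → s (j ℕ.+ i)))
    ≡⟨ cong₂ (λ u v → x ℤ.* u ℤ.+ (ℤ.- c) ℤ.* v) (descend-solves h x sol j (ℕ.<⇒≤ j<J)) (sol j (ℕ.<⇒≤ j<J)) ⟩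
  x ℤ.* 0ℤ ℤ.+ (ℤ.- c) ℤ.* 0ℤ
    ≡⟨ cong₂ ℤ._+_ (ℤ.*-zeroʳ x) (ℤ.*-zeroʳ (ℤ.- c)) ⟩
  0ℤ ∎
  where
  open ≡-Reasoning
  c = eval h x
  t = descend h x s

-- Dominance of the leading coefficient and descent on integer solutions

sumℕ-cross-mono : ∀ {m} (u v : Vector ℕ m) k T → (∀ i → u i ℕ.* k ≤ T ℕ.* v i) → sumℕ u ℕ.* k ≤ T ℕ.* sumℕ v
sumℕ-cross-mono {zero}  u v k T h = z≤n
sumℕ-cross-mono {suc m} u v k T h = begin
  (u Fin.zero ℕ.+ sumℕ (u ∘ Fin.suc)) ℕ.* k               ≡⟨ ℕ.*-distribʳ-+ k (u Fin.zero) _ ⟩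
  u Fin.zero ℕ.* k ℕ.+ sumℕ (u ∘ Fin.suc) ℕ.* k
    ≤⟨ ℕ.+-mono-≤ (h Fin.zero) (sumℕ-cross-mono (u ∘ Fin.suc) (v ∘ Fin.suc) k T (h ∘ Fin.suc)) ⟩
  T ℕ.* v Fin.zero ℕ.+ T ℕ.* sumℕ (v ∘ Fin.suc)           ≡⟨ ℕ.*-distribˡ-+ T (v Fin.zero) _ ⟨
  T ℕ.* (v Fin.zero ℕ.+ sumℕ (v ∘ Fin.suc))               ∎
  where open ℕ.≤-Reasoning

argmax : ∀ (y : ℕ → ℕ) m → ∃[ i ] i < suc m × (∀ j → j < suc m → y j ≤ y i)
argmax y zero    = 0 , s≤s z≤n , λ { zero _ → ℕ.≤-refl ; (suc _) (s≤s ()) }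
argmax y (suc m) with argmax (y ∘ suc) m
... | i , i<m , max with ℕ.≤-total (y 0) (y (suc i))
...   | inj₁ y₀≤ = suc i , s≤s i<m , λ { zero _ → y₀≤ ; (suc j) (s≤s j<m) → max j j<m }
...   | inj₂ ≤y₀ = 0 , s≤s z≤n , λ { zero _ → ℕ.≤-refl ; (suc j) (s≤s j<m) → ℕ.≤-trans (max j j<m) ≤y₀ }

climb : ∀ {T} (y : ℕ → ℕ) m → (∀ i → i < m → T ≤ y i → T ≤ y (suc i)) →
  ∀ i → i ≤ m → T ≤ y i → T ≤ y m
climb y m       step i i≤m T≤yᵢ with ℕ.m≤n⇒m<n∨m≡n i≤m
climb y m       step i i≤m T≤yᵢ | inj₂ refl        = T≤yᵢ
climb y (suc m) step i i≤m T≤yᵢ | inj₁ (s≤s i≤m′) =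
  step m ℕ.≤-refl (climb y m (λ j j<m → step j (ℕ.m≤n⇒m≤1+n j<m)) i i≤m′ T≤yᵢ)

^∸-suc : ∀ N {m i} → i < m → N ℕ.^ (m ℕ.∸ i) ≡ N ℕ.* N ℕ.^ (m ℕ.∸ suc i)
^∸-suc N {suc m} {zero}  _         = refl
^∸-suc N {suc m} {suc i} (s≤s i<m) = ^∸-suc N i<m

-- The inequality assumed for α, at a natural number `N`.
Dominant : ∀ {m} → Vector ℤ (suc m) → ℕ → Set
Dominant {m} a N = sumℕ (λ (i : Fin m) → ∣ a (inject₁ i) ∣ ℕ.* N ℕ.^ toℕ i) < ∣ a (Fin.fromℕ m) ∣ ℕ.* N ℕ.^ m

polynomial-∙-tail : ∀ {m} (a : Vector ℤ (suc m)) t →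
  ∣ polynomial a ∙ t ℤ.- a (Fin.fromℕ m) ℤ.* t m ∣ ≤ sumℕ (λ (i : Fin m) → ∣ a (inject₁ i) ∣ ℕ.* ∣ t (toℕ i) ∣)
polynomial-∙-tail {zero} a t = ℕ.≤-reflexive (cong ∣_∣ (cancel (a Fin.zero) (t 0)))
  where
  cancel : ∀ a t → a ℤ.* t ℤ.+ 0ℤ ℤ.- a ℤ.* t ≡ 0ℤ
  cancel = solve-∀
polynomial-∙-tail {suc m} a t = begin
  ∣ x ℤ.+ y ℤ.- z ∣        ≡⟨ cong ∣_∣ (ℤ.+-assoc x y (ℤ.- z)) ⟩
  ∣ x ℤ.+ (y ℤ.- z) ∣      ≤⟨ ℤ.∣i+j∣≤∣i∣+∣j∣ x (y ℤ.- z) ⟩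
  ∣ x ∣ ℕ.+ ∣ y ℤ.- z ∣
    ≤⟨ ℕ.+-mono-≤ (ℕ.≤-reflexive (ℤ.abs-* (a Fin.zero) (t 0))) (polynomial-∙-tail (a ∘ Fin.suc) (t ∘ suc)) ⟩
  _                        ∎
  where
  open ℕ.≤-Reasoning
  x = a Fin.zero ℤ.* t 0
  y = polynomial (a ∘ Fin.suc) ∙ (t ∘ suc)
  z = a (Fin.fromℕ (suc m)) ℤ.* t (suc m)

polynomial-∙≡0 : ∀ {m} (a : Vector ℤ (suc m)) t → polynomial a ∙ t ≡ 0ℤ →
  ∣ a (Fin.fromℕ m) ∣ ℕ.* ∣ t m ∣ ≤ sumℕ (λ (i : Fin m) → ∣ a (inject₁ i) ∣ ℕ.* ∣ t (toℕ i) ∣)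
polynomial-∙≡0 {m} a t f∙t≡0 = ℕ.≤-trans (ℕ.≤-reflexive (sym (begin
  ∣ polynomial a ∙ t ℤ.- z ∣   ≡⟨ cong (λ y → ∣ y ℤ.- z ∣) f∙t≡0 ⟩
  ∣ 0ℤ ℤ.- z ∣                 ≡⟨ cong ∣_∣ (ℤ.+-identityˡ (ℤ.- z)) ⟩
  ∣ ℤ.- z ∣                    ≡⟨ ℤ.∣-i∣≡∣i∣ z ⟩
  ∣ z ∣                        ≡⟨ ℤ.abs-* (a (Fin.fromℕ m)) (t m) ⟩
  ∣ a (Fin.fromℕ m) ∣ ℕ.* ∣ t m ∣ ∎))) (polynomial-∙-tail a t)
  where
  open ≡-Reasoning
  z = a (Fin.fromℕ m) ℤ.* t m

-- The recurrence expresses aₘ tₘ through the earlier terms, which are at most T Nⁱ⁻ᵐ. Hence |tₘ| ≥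
-- T would give T |aₘ| Nᵐ ≤ T Σ |aᵢ| Nⁱ, against dominance since T > 0. This bound takes the place
-- of the location of the roots.
dominant-last< : ∀ {m} (a : Vector ℤ (suc m)) N → Dominant a N →
  ∀ t T → 1 ≤ T → polynomial a ∙ t ≡ 0ℤ → (∀ i → i < m → ∣ t i ∣ ℕ.* N ℕ.^ (m ℕ.∸ i) ≤ T) → ∣ t m ∣ < T
dominant-last< {m} a N dom t T@(suc _) 1≤T f∙t≡0 t≤T = ℕ.≰⇒> λ T≤tₘ → ℕ.<-irrefl refl (begin-strict
  T ℕ.* (A ℕ.* N ℕ.^ m)       ≤⟨ ℕ.*-monoˡ-≤ (A ℕ.* N ℕ.^ m) T≤tₘ ⟩
  ∣ t m ∣ ℕ.* (A ℕ.* N ℕ.^ m) ≡⟨ swap (∣ t m ∣) A (N ℕ.^ m) ⟩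
  A ℕ.* ∣ t m ∣ ℕ.* N ℕ.^ m   ≤⟨ ℕ.*-monoˡ-≤ (N ℕ.^ m) (polynomial-∙≡0 a t f∙t≡0) ⟩
  sumℕ u ℕ.* N ℕ.^ m          ≤⟨ sumℕ-cross-mono u v (N ℕ.^ m) T weighted ⟩
  T ℕ.* sumℕ v                <⟨ ℕ.*-monoʳ-< T dom ⟩
  T ℕ.* (A ℕ.* N ℕ.^ m)       ∎)
  where
  open ℕ.≤-Reasoning
  A = ∣ a (Fin.fromℕ m) ∣
  u v : Vector ℕ m
  u i = ∣ a (inject₁ i) ∣ ℕ.* ∣ t (toℕ i) ∣
  v i = ∣ a (inject₁ i) ∣ ℕ.* N ℕ.^ toℕ i
  swap : ∀ x y z → x ℕ.* (y ℕ.* z) ≡ y ℕ.* x ℕ.* z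
  swap = solve 3 (λ x y z → x :* (y :* z) := y :* x :* z) refl where open +-*-Solver
  weighted : ∀ i → u i ℕ.* N ℕ.^ m ≤ T ℕ.* v i
  weighted i = begin
    b ℕ.* y ℕ.* N ℕ.^ m                              ≡⟨ cong (λ e → b ℕ.* y ℕ.* N ℕ.^ e) (ℕ.m∸n+n≡m (ℕ.<⇒≤ i<m)) ⟨
    b ℕ.* y ℕ.* N ℕ.^ (m ℕ.∸ toℕ i ℕ.+ toℕ i)        ≡⟨ cong (b ℕ.* y ℕ.*_) (ℕ.^-distribˡ-+-* N (m ℕ.∸ toℕ i) (toℕ i)) ⟩
    b ℕ.* y ℕ.* (N ℕ.^ (m ℕ.∸ toℕ i) ℕ.* N ℕ.^ toℕ i) ≡⟨ regroup b y (N ℕ.^ (m ℕ.∸ toℕ i)) (N ℕ.^ toℕ i) ⟩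
    y ℕ.* N ℕ.^ (m ℕ.∸ toℕ i) ℕ.* (b ℕ.* N ℕ.^ toℕ i) ≤⟨ ℕ.*-monoˡ-≤ (b ℕ.* N ℕ.^ toℕ i) (t≤T (toℕ i) i<m) ⟩
    T ℕ.* (b ℕ.* N ℕ.^ toℕ i)                        ∎
    where
    b = ∣ a (inject₁ i) ∣
    y = ∣ t (toℕ i) ∣
    i<m = Fin.toℕ<n i
    regroup : ∀ b y w x → b ℕ.* y ℕ.* (w ℕ.* x) ≡ y ℕ.* w ℕ.* (b ℕ.* x)
    regroup = solve 4 (λ b y w x → b :* y :* (w :* x) := y :* w :* (b :* x)) refl where open +-*-Solver

-- The polynomial `h` is tied to f only through `factor`, so the same descent serves a left and a
-- right factor.
module _ {m} (a : Vector ℤ (suc (suc m))) (N d : ℕ) .{{_ : ℕ.NonZero N}} (dom : Dominant a N)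
         (h : Polynomial) (J : ℕ) (factor : ∀ s → Solves J h s → polynomial a ∙ s ≡ 0ℤ)
         (h[x]≢0 : eval h (+ (N ℕ.+ d)) ≢ 0ℤ) (h[x]≤d : ∣ eval h (+ (N ℕ.+ d)) ∣ ≤ d) where

  private
    M = suc m
    x = + (N ℕ.+ d)
    c = eval h x

    -- This is |sᵢ| N⁻ⁱ scaled by `N ^ M`, which makes it a natural number for i ≤ M.
    size : (ℕ → ℤ) → ℕ → ℕ
    size s i = ∣ s i ∣ ℕ.* N ℕ.^ (M ℕ.∸ i)

    size≡0 : ∀ s i → size s i ≡ 0 → s i ≡ 0ℤ
    size≡0 s i sz≡0 with ℕ.m*n≡0⇒m≡0∨n≡0 ∣ s i ∣ sz≡0
    ... | inj₁ s≡0 = ℤ.∣i∣≡0⇒i≡0 s≡0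
    ... | inj₂ N≡0 = contradiction (ℕ.m^n≡0⇒m≡0 N (M ℕ.∸ i) N≡0) (ℕ.≢-nonZero⁻¹ N)

    size-last : ∀ s → size s M ≡ ∣ s M ∣
    size-last s = trans (cong (λ e → ∣ s M ∣ ℕ.* N ℕ.^ e) (ℕ.n∸n≡0 M)) (ℕ.*-identityʳ _)

    -- The triangle inequality in x tᵢ = tᵢ₊₁ + c sᵢ with |c| ≤ d; the weight at `i` is `N` times
    -- the weight at `suc i`.
    size-descend : ∀ s i → i < M → let t = descend h x s in
      (N ℕ.+ d) ℕ.* size t i ≤ N ℕ.* size t (suc i) ℕ.+ d ℕ.* size s i
    size-descend s i i<M = begin
      (N ℕ.+ d) ℕ.* (∣ t i ∣ ℕ.* W)                          ≡⟨ ℕ.*-assoc (N ℕ.+ d) ∣ t i ∣ W ⟨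
      (N ℕ.+ d) ℕ.* ∣ t i ∣ ℕ.* W                            ≡⟨ cong (ℕ._* W) (ℤ.abs-* x (t i)) ⟨
      ∣ x ℤ.* t i ∣ ℕ.* W                                    ≡⟨ cong (λ y → ∣ y ∣ ℕ.* W) (split (x ℤ.* t i) (c ℤ.* s i)) ⟩
      ∣ t (suc i) ℤ.+ c ℤ.* s i ∣ ℕ.* W                      ≤⟨ ℕ.*-monoˡ-≤ W (ℤ.∣i+j∣≤∣i∣+∣j∣ (t (suc i)) (c ℤ.* s i)) ⟩
      (∣ t (suc i) ∣ ℕ.+ ∣ c ℤ.* s i ∣) ℕ.* W                ≡⟨ cong (λ y → (∣ t (suc i) ∣ ℕ.+ y) ℕ.* W) (ℤ.abs-* c (s i)) ⟩
      (∣ t (suc i) ∣ ℕ.+ ∣ c ∣ ℕ.* ∣ s i ∣) ℕ.* W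
        ≤⟨ ℕ.*-monoˡ-≤ W (ℕ.+-monoʳ-≤ ∣ t (suc i) ∣ (ℕ.*-monoˡ-≤ ∣ s i ∣ h[x]≤d)) ⟩
      (∣ t (suc i) ∣ ℕ.+ d ℕ.* ∣ s i ∣) ℕ.* W                ≡⟨ distrib (∣ t (suc i) ∣) d (∣ s i ∣) W ⟩
      ∣ t (suc i) ∣ ℕ.* W ℕ.+ d ℕ.* size s i
        ≡⟨ cong (λ w → ∣ t (suc i) ∣ ℕ.* w ℕ.+ d ℕ.* size s i) (^∸-suc N i<M) ⟩
      ∣ t (suc i) ∣ ℕ.* (N ℕ.* V) ℕ.+ d ℕ.* size s i         ≡⟨ cong (ℕ._+ d ℕ.* size s i) (swap (∣ t (suc i) ∣) N V) ⟩
      N ℕ.* size t (suc i) ℕ.+ d ℕ.* size s i                ∎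
      where
      open ℕ.≤-Reasoning
      t = descend h x s
      W = N ℕ.^ (M ℕ.∸ i)
      V = N ℕ.^ (M ℕ.∸ suc i)
      split : ∀ u v → u ≡ (u ℤ.- v) ℤ.+ v
      split = solve-∀
      open +-*-Solver using (solve; _:=_; _:*_; _:+_)
      distrib : ∀ u d v w → (u ℕ.+ d ℕ.* v) ℕ.* w ≡ u ℕ.* w ℕ.+ d ℕ.* (v ℕ.* w)
      distrib = solve 4 (λ u d v w → (u :+ d :* v) :* w := u :* w :+ d :* (v :* w)) refl
      swap : ∀ u v w → u ℕ.* (v ℕ.* w) ≡ v ℕ.* (u ℕ.* w)
      swap = solve 3 (λ u v w → u :* (v :* w) := v :* (u :* w)) refl

    -- Dominance with T = 1 extends the vanishing of t to index `M`. Then c sᵢ = x tᵢ - tᵢ₊₁ = 0 for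
    -- all i < M, and c ≠ 0.
    descend≡0⇒≡0 : ∀ s → Solves J h s → (∀ i → i < M → descend h x s i ≡ 0ℤ) → ∀ i → i < M → s i ≡ 0ℤ
    descend≡0⇒≡0 s sol t≡0 i i<M with ℤ.i*j≡0⇒i≡0∨j≡0 c cs≡0
      where
      t = descend h x s
      tₘ≡0 : t M ≡ 0ℤ
      tₘ≡0 = ℤ.∣i∣≡0⇒i≡0 (ℕ.n<1⇒n≡0 (dominant-last< a N dom t 1 ℕ.≤-refl (factor t (descend-solves h x sol))
        (λ j j<M → ℕ.≤-trans (ℕ.≤-reflexive (cong (λ y → ∣ y ∣ ℕ.* N ℕ.^ (M ℕ.∸ j)) (t≡0 j j<M))) z≤n)))
      t′≡0 : t (suc i) ≡ 0ℤ
      t′≡0 with ℕ.m≤n⇒m<n∨m≡n i<M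
      ... | inj₁ 1+i<M = t≡0 (suc i) 1+i<M
      ... | inj₂ refl  = tₘ≡0
      isolate : ∀ x y z → z ≡ x ℤ.* y ℤ.- (x ℤ.* y ℤ.- z)
      isolate = solve-∀
      cs≡0 : c ℤ.* s i ≡ 0ℤ
      cs≡0 = trans (isolate x (t i) (c ℤ.* s i)) (trans (cong₂ (λ u v → x ℤ.* u ℤ.- v) (t≡0 i i<M) t′≡0)
        (trans (ℤ.+-identityʳ _) (ℤ.*-zeroʳ x)))
    ... | inj₁ c≡0 = contradiction c≡0 h[x]≢0
    ... | inj₂ s≡0 = s≡0

    -- Let T be the largest size of t below `M`, and suppose T > B. All sizes of `s` are then at
    -- most T, so `size-descend` turns size T at `i` into size at least T at `suc i`. Climbing to
    -- `M` gives |t_M| ≥ T, against `dominant-last<`.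
    shrink : ∀ B s → Solves J h s → (∀ i → i < M → size s i ≤ suc B) →
      ∀ i → i < M → size (descend h x s) i ≤ B
    shrink B s sol s≤ with argmax (size (descend h x s)) m
    ... | k , k<M , max with size (descend h x s) k ℕ.≤? B
    ...   | yes tₖ≤B = λ i i<M → ℕ.≤-trans (max i i<M) tₖ≤B
    ...   | no  tₖ≰B = contradiction (dominant-last< a N dom t T (ℕ.≤-trans (s≤s z≤n) B<T) (factor t (descend-solves h x sol)) max)
                (ℕ.≤⇒≯ (subst (T ≤_) (size-last t) (climb (size t) M step k (ℕ.<⇒≤ k<M) ℕ.≤-refl)))
      where
      t = descend h x s
      T = size t k
      B<T : B < T
      B<T = ℕ.≰⇒> tₖ≰B
      step : ∀ i → i < M → T ≤ size t i → T ≤ size t (suc i)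
      step i i<M T≤tᵢ = ℕ.*-cancelˡ-≤ N (ℕ.+-cancelʳ-≤ (d ℕ.* T) (N ℕ.* T) (N ℕ.* size t (suc i)) (begin
        N ℕ.* T ℕ.+ d ℕ.* T                          ≡⟨ ℕ.*-distribʳ-+ T N d ⟨
        (N ℕ.+ d) ℕ.* T                              ≤⟨ ℕ.*-monoʳ-≤ (N ℕ.+ d) T≤tᵢ ⟩
        (N ℕ.+ d) ℕ.* size t i                       ≤⟨ size-descend s i i<M ⟩
        N ℕ.* size t (suc i) ℕ.+ d ℕ.* size s i
          ≤⟨ ℕ.+-monoʳ-≤ (N ℕ.* size t (suc i)) (ℕ.*-monoʳ-≤ d (ℕ.≤-trans (s≤ i i<M) B<T)) ⟩
        N ℕ.* size t (suc i) ℕ.+ d ℕ.* T             ∎))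
        where open ℕ.≤-Reasoning

  -- Infinite descent: q(S) s satisfies the bound lowered by one, so it vanishes by induction, and
  -- hence so does `s`.
  solution≡0 : ∀ B s → Solves J h s → (∀ i → i < M → size s i ≤ B) → ∀ i → i < M → s i ≡ 0ℤ
  solution≡0 zero    s sol s≤ i i<M = size≡0 s i (ℕ.n≤0⇒n≡0 (s≤ i i<M))
  solution≡0 (suc B) s sol s≤ =
    descend≡0⇒≡0 s sol (solution≡0 B (descend h x s) (descend-solves h x sol) (shrink B s sol s≤))

  solution₀≡0 : ∀ s → Solves J h s → s 0 ≡ 0ℤ
  solution₀≡0 s sol with argmax (size s) m
  ... | k , _ , max = solution≡0 (size s k) s sol max 0 (s≤s z≤n)

-- Taylor shift

coeff-+ₚ : ∀ f g i → coeff (f +ₚ g) i ≡ coeff f i ℤ.+ coeff g i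
coeff-+ₚ []      g       i       = sym (ℤ.+-identityˡ _)
coeff-+ₚ (a ∷ f) []      i       = sym (ℤ.+-identityʳ _)
coeff-+ₚ (a ∷ f) (b ∷ g) zero    = refl
coeff-+ₚ (a ∷ f) (b ∷ g) (suc i) = coeff-+ₚ f g i

coeff-map-* : ∀ c f i → coeff (List.map (c ℤ.*_) f) i ≡ c ℤ.* coeff f i
coeff-map-* c []      i       = sym (ℤ.*-zeroʳ c)
coeff-map-* c (a ∷ f) zero    = refl
coeff-map-* c (a ∷ f) (suc i) = coeff-map-* c f i

coeff-*ₚ-zero : ∀ f g → coeff (f *ₚ g) 0 ≡ coeff f 0 ℤ.* coeff g 0
coeff-*ₚ-zero []      g = refl
coeff-*ₚ-zero (a ∷ f) g = trans (coeff-+ₚ (List.map (a ℤ.*_) g) _ 0) (trans (ℤ.+-identityʳ _) (coeff-map-* a g 0))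

coeff-∷-*ₚ : ∀ a f g i → coeff ((a ∷ f) *ₚ g) (suc i) ≡ a ℤ.* coeff g (suc i) ℤ.+ coeff (f *ₚ g) i
coeff-∷-*ₚ a f g i = trans (coeff-+ₚ (List.map (a ℤ.*_) g) _ (suc i))
  (cong (ℤ._+ coeff (f *ₚ g) i) (coeff-map-* a g (suc i)))

coeff-*ₚ-distribʳ : ∀ f g h i → coeff ((f +ₚ g) *ₚ h) i ≡ coeff (f *ₚ h) i ℤ.+ coeff (g *ₚ h) i
coeff-*ₚ-distribʳ []      g       h i = sym (ℤ.+-identityˡ _)
coeff-*ₚ-distribʳ (a ∷ f) []      h i = sym (ℤ.+-identityʳ _)
coeff-*ₚ-distribʳ (a ∷ f) (b ∷ g) h zero
  rewrite coeff-*ₚ-zero (a ℤ.+ b ∷ f +ₚ g) h | coeff-*ₚ-zero (a ∷ f) h | coeff-*ₚ-zero (b ∷ g) h =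
  ℤ.*-distribʳ-+ (coeff h 0) a b
coeff-*ₚ-distribʳ (a ∷ f) (b ∷ g) h (suc i)
  rewrite coeff-∷-*ₚ (a ℤ.+ b) (f +ₚ g) h i | coeff-∷-*ₚ a f h i | coeff-∷-*ₚ b g h i | coeff-*ₚ-distribʳ f g h i =
  interchange a b (coeff h (suc i)) (coeff (f *ₚ h) i) (coeff (g *ₚ h) i)
  where
  interchange : ∀ a b x u v →
    (a ℤ.+ b) ℤ.* x ℤ.+ (u ℤ.+ v) ≡ (a ℤ.* x ℤ.+ u) ℤ.+ (b ℤ.* x ℤ.+ v)
  interchange = solve-∀

coeff-map-*-*ₚ : ∀ c f g i → coeff (List.map (c ℤ.*_) f *ₚ g) i ≡ c ℤ.* coeff (f *ₚ g) i
coeff-map-*-*ₚ c []      g i = sym (ℤ.*-zeroʳ c)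
coeff-map-*-*ₚ c (a ∷ f) g zero
  rewrite coeff-*ₚ-zero (c ℤ.* a ∷ List.map (c ℤ.*_) f) g | coeff-*ₚ-zero (a ∷ f) g = ℤ.*-assoc c a _
coeff-map-*-*ₚ c (a ∷ f) g (suc i)
  rewrite coeff-∷-*ₚ (c ℤ.* a) (List.map (c ℤ.*_) f) g i | coeff-∷-*ₚ a f g i | coeff-map-*-*ₚ c f g i =
  factor c a (coeff g (suc i)) (coeff (f *ₚ g) i)
  where
  factor : ∀ c a x u → c ℤ.* a ℤ.* x ℤ.+ c ℤ.* u ≡ c ℤ.* (a ℤ.* x ℤ.+ u)
  factor = solve-∀

-- taylor x f = f(x + z)
taylor : ℤ → Polynomial → Polynomial
taylor x []      = []
taylor x (a ∷ f) = (a ∷ []) +ₚ (List.map (x ℤ.*_) (taylor x f) +ₚ (0ℤ ∷ taylor x f))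

coeff-taylor-∷-zero : ∀ x a f → coeff (taylor x (a ∷ f)) 0 ≡ a ℤ.+ x ℤ.* coeff (taylor x f) 0
coeff-taylor-∷-zero x a f
  rewrite coeff-+ₚ (a ∷ []) (List.map (x ℤ.*_) (taylor x f) +ₚ (0ℤ ∷ taylor x f)) 0
        | coeff-+ₚ (List.map (x ℤ.*_) (taylor x f)) (0ℤ ∷ taylor x f) 0
        | coeff-map-* x (taylor x f) 0 = cong (λ y → a ℤ.+ y) (ℤ.+-identityʳ _)

coeff-taylor-∷-suc : ∀ x a f i →
  coeff (taylor x (a ∷ f)) (suc i) ≡ x ℤ.* coeff (taylor x f) (suc i) ℤ.+ coeff (taylor x f) i
coeff-taylor-∷-suc x a f i
  rewrite coeff-+ₚ (a ∷ []) (List.map (x ℤ.*_) (taylor x f) +ₚ (0ℤ ∷ taylor x f)) (suc i)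
        | coeff-+ₚ (List.map (x ℤ.*_) (taylor x f)) (0ℤ ∷ taylor x f) (suc i)
        | coeff-map-* x (taylor x f) (suc i) = ℤ.+-identityˡ _

coeff-taylor-0 : ∀ x f → coeff (taylor x f) 0 ≡ eval f x
coeff-taylor-0 x []      = refl
coeff-taylor-0 x (a ∷ f) = trans (coeff-taylor-∷-zero x a f) (cong (λ y → a ℤ.+ x ℤ.* y) (coeff-taylor-0 x f))

taylor-≈0 : ∀ x f → (∀ i → coeff f i ≡ 0ℤ) → ∀ i → coeff (taylor x f) i ≡ 0ℤ
taylor-≈0 x []      f≈0 i = refl
taylor-≈0 x (a ∷ f) f≈0 zero
  rewrite coeff-taylor-∷-zero x a f | f≈0 0 | taylor-≈0 x f (f≈0 ∘ suc) 0 = trans (ℤ.+-identityˡ _) (ℤ.*-zeroʳ x)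
taylor-≈0 x (a ∷ f) f≈0 (suc i)
  rewrite coeff-taylor-∷-suc x a f i | taylor-≈0 x f (f≈0 ∘ suc) i | taylor-≈0 x f (f≈0 ∘ suc) (suc i) =
  trans (ℤ.+-identityʳ _) (ℤ.*-zeroʳ x)

taylor-cong : ∀ x f g → f ≈ₚ g → taylor x f ≈ₚ taylor x g
taylor-cong x []      g       f≈g i = sym (taylor-≈0 x g (sym ∘ f≈g) i)
taylor-cong x (a ∷ f) []      f≈g i = taylor-≈0 x (a ∷ f) f≈g i
taylor-cong x (a ∷ f) (b ∷ g) f≈g zero
  rewrite coeff-taylor-∷-zero x a f | coeff-taylor-∷-zero x b g | f≈g 0 | taylor-cong x f g (f≈g ∘ suc) 0 = refl
taylor-cong x (a ∷ f) (b ∷ g) f≈g (suc i)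
  rewrite coeff-taylor-∷-suc x a f i | coeff-taylor-∷-suc x b g i
        | taylor-cong x f g (f≈g ∘ suc) i | taylor-cong x f g (f≈g ∘ suc) (suc i) = refl

coeff-taylor-+ₚ : ∀ x f g i → coeff (taylor x (f +ₚ g)) i ≡ coeff (taylor x f) i ℤ.+ coeff (taylor x g) i
coeff-taylor-+ₚ x []      g       i = sym (ℤ.+-identityˡ _)
coeff-taylor-+ₚ x (a ∷ f) []      i = sym (ℤ.+-identityʳ _)
coeff-taylor-+ₚ x (a ∷ f) (b ∷ g) zero
  rewrite coeff-taylor-∷-zero x (a ℤ.+ b) (f +ₚ g) | coeff-taylor-∷-zero x a f | coeff-taylor-∷-zero x b g
        | coeff-taylor-+ₚ x f g 0 = interchange a b x (coeff (taylor x f) 0) (coeff (taylor x g) 0)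
  where
  interchange : ∀ a b x u v → (a ℤ.+ b) ℤ.+ x ℤ.* (u ℤ.+ v) ≡ (a ℤ.+ x ℤ.* u) ℤ.+ (b ℤ.+ x ℤ.* v)
  interchange = solve-∀
coeff-taylor-+ₚ x (a ∷ f) (b ∷ g) (suc i)
  rewrite coeff-taylor-∷-suc x (a ℤ.+ b) (f +ₚ g) i | coeff-taylor-∷-suc x a f i | coeff-taylor-∷-suc x b g i
        | coeff-taylor-+ₚ x f g i | coeff-taylor-+ₚ x f g (suc i) =
  interchange x (coeff (taylor x f) i) (coeff (taylor x g) i) (coeff (taylor x f) (suc i)) (coeff (taylor x g) (suc i))
  where
  interchange : ∀ x t u v w → x ℤ.* (v ℤ.+ w) ℤ.+ (t ℤ.+ u) ≡ (x ℤ.* v ℤ.+ t) ℤ.+ (x ℤ.* w ℤ.+ u)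
  interchange = solve-∀

coeff-taylor-map-* : ∀ x c f i → coeff (taylor x (List.map (c ℤ.*_) f)) i ≡ c ℤ.* coeff (taylor x f) i
coeff-taylor-map-* x c []      i = sym (ℤ.*-zeroʳ c)
coeff-taylor-map-* x c (a ∷ f) zero
  rewrite coeff-taylor-∷-zero x (c ℤ.* a) (List.map (c ℤ.*_) f) | coeff-taylor-∷-zero x a f
        | coeff-taylor-map-* x c f 0 = factor c a x (coeff (taylor x f) 0)
  where
  factor : ∀ c a x u → c ℤ.* a ℤ.+ x ℤ.* (c ℤ.* u) ≡ c ℤ.* (a ℤ.+ x ℤ.* u)
  factor = solve-∀
coeff-taylor-map-* x c (a ∷ f) (suc i)
  rewrite coeff-taylor-∷-suc x (c ℤ.* a) (List.map (c ℤ.*_) f) i | coeff-taylor-∷-suc x a f i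
        | coeff-taylor-map-* x c f i | coeff-taylor-map-* x c f (suc i) =
  factor c x (coeff (taylor x f) (suc i)) (coeff (taylor x f) i)
  where
  factor : ∀ c x u v → x ℤ.* (c ℤ.* u) ℤ.+ c ℤ.* v ≡ c ℤ.* (x ℤ.* u ℤ.+ v)
  factor = solve-∀

-- Since f(x + z) unfolds to a + x F + z F, the product with G splits into three products, matched
-- with the recursion of `_*ₚ_` on `f`.
taylor-*ₚ : ∀ x f g → taylor x (f *ₚ g) ≈ₚ taylor x f *ₚ taylor x g
taylor-*ₚ x []      g i = refl
taylor-*ₚ x (a ∷ f) g i = begin
  coeff (taylor x (List.map (a ℤ.*_) g +ₚ (0ℤ ∷ f *ₚ g))) i
    ≡⟨ coeff-taylor-+ₚ x (List.map (a ℤ.*_) g) (0ℤ ∷ f *ₚ g) i ⟩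
  coeff (taylor x (List.map (a ℤ.*_) g)) i ℤ.+ coeff (taylor x (0ℤ ∷ f *ₚ g)) i
    ≡⟨ cong (ℤ._+ coeff (taylor x (0ℤ ∷ f *ₚ g)) i) (coeff-taylor-map-* x a g i) ⟩
  a ℤ.* coeff G i ℤ.+ coeff (taylor x (0ℤ ∷ f *ₚ g)) i
    ≡⟨ step i ⟩
  coeff ((a ∷ []) *ₚ G) i ℤ.+ (x ℤ.* coeff (F *ₚ G) i ℤ.+ coeff ((0ℤ ∷ F) *ₚ G) i)
    ≡⟨ cong (λ y → coeff ((a ∷ []) *ₚ G) i ℤ.+ (y ℤ.+ coeff ((0ℤ ∷ F) *ₚ G) i)) (coeff-map-*-*ₚ x F G i) ⟨
  coeff ((a ∷ []) *ₚ G) i ℤ.+ (coeff (List.map (x ℤ.*_) F *ₚ G) i ℤ.+ coeff ((0ℤ ∷ F) *ₚ G) i)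
    ≡⟨ cong (λ y → coeff ((a ∷ []) *ₚ G) i ℤ.+ y) (coeff-*ₚ-distribʳ (List.map (x ℤ.*_) F) (0ℤ ∷ F) G i) ⟨
  coeff ((a ∷ []) *ₚ G) i ℤ.+ coeff ((List.map (x ℤ.*_) F +ₚ (0ℤ ∷ F)) *ₚ G) i
    ≡⟨ coeff-*ₚ-distribʳ (a ∷ []) (List.map (x ℤ.*_) F +ₚ (0ℤ ∷ F)) G i ⟨
  coeff (taylor x (a ∷ f) *ₚ G) i ∎
  where
  open ≡-Reasoning
  F = taylor x f
  G = taylor x g
  step : ∀ i → a ℤ.* coeff G i ℤ.+ coeff (taylor x (0ℤ ∷ f *ₚ g)) i ≡
    coeff ((a ∷ []) *ₚ G) i ℤ.+ (x ℤ.* coeff (F *ₚ G) i ℤ.+ coeff ((0ℤ ∷ F) *ₚ G) i)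
  step zero
    rewrite coeff-taylor-∷-zero x 0ℤ (f *ₚ g) | taylor-*ₚ x f g 0 | coeff-*ₚ-zero (a ∷ []) G | coeff-*ₚ-zero (0ℤ ∷ F) G =
    rearrange (a ℤ.* coeff G 0) (x ℤ.* coeff (F *ₚ G) 0)
    where
    rearrange : ∀ u v → u ℤ.+ (0ℤ ℤ.+ v) ≡ u ℤ.+ (v ℤ.+ 0ℤ)
    rearrange = solve-∀
  step (suc i)
    rewrite coeff-taylor-∷-suc x 0ℤ (f *ₚ g) i | taylor-*ₚ x f g i | taylor-*ₚ x f g (suc i)
          | coeff-∷-*ₚ a [] G i | coeff-∷-*ₚ 0ℤ F G i =
    rearrange (a ℤ.* coeff G (suc i)) (x ℤ.* coeff (F *ₚ G) (suc i)) (coeff (F *ₚ G) i)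
    where
    rearrange : ∀ u v w → u ℤ.+ (v ℤ.+ w) ≡ u ℤ.+ 0ℤ ℤ.+ (v ℤ.+ (0ℤ ℤ.+ w))
    rearrange = solve-∀

-- `weight k f` is k f + z f′. The shift turns it into k F + (x + z) F′ with F = f(x + z), and the
-- right side is its j-th coefficient.
coeff-taylor-weight : ∀ x k f j → coeff (taylor x (weight k f)) j ≡
  (+ k ℤ.+ + j) ℤ.* coeff (taylor x f) j ℤ.+ x ℤ.* ((+ j ℤ.+ 1ℤ) ℤ.* coeff (taylor x f) (suc j))
coeff-taylor-weight x k []      j = vanish (+ k ℤ.+ + j) x (+ j ℤ.+ 1ℤ)
  where
  vanish : ∀ u x v → 0ℤ ≡ u ℤ.* 0ℤ ℤ.+ x ℤ.* (v ℤ.* 0ℤ)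
  vanish = solve-∀
coeff-taylor-weight x k (b ∷ f) zero
  rewrite coeff-taylor-∷-zero x (+ k ℤ.* b) (weight (suc k) f) | coeff-taylor-weight x (suc k) f 0
        | coeff-taylor-∷-zero x b f | coeff-taylor-∷-suc x b f 0 =
  step x (+ k) b (coeff (taylor x f) 0) (coeff (taylor x f) 1)
  where
  step : ∀ x k b u v → k ℤ.* b ℤ.+ x ℤ.* ((1ℤ ℤ.+ k ℤ.+ 0ℤ) ℤ.* u ℤ.+ x ℤ.* (1ℤ ℤ.* v)) ≡
    (k ℤ.+ 0ℤ) ℤ.* (b ℤ.+ x ℤ.* u) ℤ.+ x ℤ.* (1ℤ ℤ.* (x ℤ.* v ℤ.+ u))
  step = solve-∀
coeff-taylor-weight x k (b ∷ f) (suc j)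
  rewrite coeff-taylor-∷-suc x (+ k ℤ.* b) (weight (suc k) f) j
        | coeff-taylor-weight x (suc k) f j | coeff-taylor-weight x (suc k) f (suc j)
        | coeff-taylor-∷-suc x b f j | coeff-taylor-∷-suc x b f (suc j) =
  step x (+ k) (+ j) (coeff (taylor x f) j) (coeff (taylor x f) (suc j)) (coeff (taylor x f) (suc (suc j)))
  where
  step : ∀ x k j u v w →
    x ℤ.* ((1ℤ ℤ.+ k ℤ.+ (1ℤ ℤ.+ j)) ℤ.* v ℤ.+ x ℤ.* ((1ℤ ℤ.+ j ℤ.+ 1ℤ) ℤ.* w)) ℤ.+
      ((1ℤ ℤ.+ k ℤ.+ j) ℤ.* u ℤ.+ x ℤ.* ((j ℤ.+ 1ℤ) ℤ.* v)) ≡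
    (k ℤ.+ (1ℤ ℤ.+ j)) ℤ.* (x ℤ.* v ℤ.+ u) ℤ.+ x ℤ.* ((1ℤ ℤ.+ j ℤ.+ 1ℤ) ℤ.* (x ℤ.* w ℤ.+ v))
  step = solve-∀

coeff-taylor-derivative : ∀ x f j → coeff (taylor x (derivative f)) j ≡ + suc j ℤ.* coeff (taylor x f) (suc j)
coeff-taylor-derivative x []      j = sym (ℤ.*-zeroʳ (+ suc j))
coeff-taylor-derivative x (a ∷ f) j
  rewrite coeff-taylor-weight x 1 f j | coeff-taylor-∷-suc x a f j =
  step x (+ j) (coeff (taylor x f) j) (coeff (taylor x f) (suc j))
  where
  step : ∀ x j u v → (1ℤ ℤ.+ j) ℤ.* u ℤ.+ x ℤ.* ((j ℤ.+ 1ℤ) ℤ.* v) ≡ (1ℤ ℤ.+ j) ℤ.* (x ℤ.* v ℤ.+ u)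
  step = solve-∀

coeff-taylor-iteratedDerivative : ∀ x i f j →
  + (j !) ℤ.* coeff (taylor x (iteratedDerivative i f)) j ≡ + ((i ℕ.+ j) !) ℤ.* coeff (taylor x f) (i ℕ.+ j)
coeff-taylor-iteratedDerivative x zero    f j = refl
coeff-taylor-iteratedDerivative x (suc i) f j = begin
  + (j !) ℤ.* coeff (taylor x (derivative g)) j            ≡⟨ cong (+ (j !) ℤ.*_) (coeff-taylor-derivative x g j) ⟩
  + (j !) ℤ.* (+ suc j ℤ.* coeff (taylor x g) (suc j))     ≡⟨ ℤ.*-assoc (+ (j !)) (+ suc j) _ ⟨
  + (j !) ℤ.* + suc j ℤ.* coeff (taylor x g) (suc j)
    ≡⟨ cong (ℤ._* coeff (taylor x g) (suc j)) (ℤ.*-comm (+ (j !)) (+ suc j)) ⟩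
  + suc j ℤ.* + (j !) ℤ.* coeff (taylor x g) (suc j)
    ≡⟨ cong (ℤ._* coeff (taylor x g) (suc j)) (ℤ.pos-* (suc j) (j !)) ⟨
  + (suc j !) ℤ.* coeff (taylor x g) (suc j)               ≡⟨ coeff-taylor-iteratedDerivative x i f (suc j) ⟩
  + ((i ℕ.+ suc j) !) ℤ.* coeff (taylor x f) (i ℕ.+ suc j) ≡⟨ cong (λ t → + (t !) ℤ.* coeff (taylor x f) t) (ℕ.+-suc i j) ⟩
  + ((suc i ℕ.+ j) !) ℤ.* coeff (taylor x f) (suc i ℕ.+ j) ∎
  where
  open ≡-Reasoning
  g = iteratedDerivative i f

-- Taylor's formula. After multiplication by i! both sides are the constant coefficient of the
-- shifted i-th derivative.
dividedDerivative≡coeff-taylor : ∀ i f x → dividedDerivative i f x ≡ coeff (taylor x f) i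
dividedDerivative≡coeff-taylor i f x = ℤ.*-cancelʳ-≡ _ _ (+ (i !)) {{i ℕ.!≢0}} (begin
  dividedDerivative i f x ℤ.* + (i !)                       ≡⟨ dividedDerivative-exact i f x ⟩
  eval (iteratedDerivative i f) x                           ≡⟨ coeff-taylor-0 x (iteratedDerivative i f) ⟨
  coeff (taylor x (iteratedDerivative i f)) 0               ≡⟨ ℤ.*-identityˡ _ ⟨
  1ℤ ℤ.* coeff (taylor x (iteratedDerivative i f)) 0        ≡⟨ coeff-taylor-iteratedDerivative x i f 0 ⟩
  + ((i ℕ.+ 0) !) ℤ.* coeff (taylor x f) (i ℕ.+ 0)
    ≡⟨ cong (λ t → + (t !) ℤ.* coeff (taylor x f) t) (ℕ.+-identityʳ i) ⟩
  + (i !) ℤ.* coeff (taylor x f) i                          ≡⟨ ℤ.*-comm (+ (i !)) _ ⟩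
  coeff (taylor x f) i ℤ.* + (i !)                          ∎)
  where open ≡-Reasoning

eval-cong : ∀ f g x → f ≈ₚ g → eval f x ≡ eval g x
eval-cong f g x f≈g = trans (sym (coeff-taylor-0 x f)) (trans (taylor-cong x f g f≈g 0) (coeff-taylor-0 x g))

-- Evaluation is the constant coefficient of the shift, so this is `taylor-*ₚ` at index 0.
eval-*ₚ : ∀ f g x → eval (f *ₚ g) x ≡ eval f x ℤ.* eval g x
eval-*ₚ f g x = begin
  eval (f *ₚ g) x                                 ≡⟨ coeff-taylor-0 x (f *ₚ g) ⟨
  coeff (taylor x (f *ₚ g)) 0                     ≡⟨ taylor-*ₚ x f g 0 ⟩
  coeff (taylor x f *ₚ taylor x g) 0              ≡⟨ coeff-*ₚ-zero (taylor x f) (taylor x g) ⟩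
  coeff (taylor x f) 0 ℤ.* coeff (taylor x g) 0   ≡⟨ cong₂ ℤ._*_ (coeff-taylor-0 x f) (coeff-taylor-0 x g) ⟩
  eval f x ℤ.* eval g x                           ∎
  where open ≡-Reasoning

-- Newton polygons

∣*ₚ : ∀ {c} f g n → (∀ i j → i ℕ.+ j ≡ n → c Signed.∣ coeff f i ℤ.* coeff g j) → c Signed.∣ coeff (f *ₚ g) n
∣*ₚ []      g n       c∣ = c∣ 0 n refl
∣*ₚ {c} (a ∷ f) g zero    c∣ = subst (c Signed.∣_) (sym (coeff-*ₚ-zero (a ∷ f) g)) (c∣ 0 0 refl)
∣*ₚ {c} (a ∷ f) g (suc n) c∣ = subst (c Signed.∣_) (sym (coeff-∷-*ₚ a f g n))
  (Signed.∣m∣n⇒∣m+n (c∣ 0 (suc n) refl) (∣*ₚ f g n (λ i j i+j≡n → c∣ (suc i) j (cong suc i+j≡n))))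

∣*ₚ⇒∣term : ∀ {c} f g i j →
  (∀ i′ j′ → i′ ℕ.+ j′ ≡ i ℕ.+ j → i′ ≢ i → c Signed.∣ coeff f i′ ℤ.* coeff g j′) →
  c Signed.∣ coeff (f *ₚ g) (i ℕ.+ j) → c Signed.∣ coeff f i ℤ.* coeff g j
∣*ₚ⇒∣term []      g i       j       others c∣fg = c∣fg
∣*ₚ⇒∣term {c} (a ∷ f) g zero    zero    others c∣fg = subst (c Signed.∣_) (coeff-*ₚ-zero (a ∷ f) g) c∣fg
∣*ₚ⇒∣term {c} (a ∷ f) g zero    (suc j) others c∣fg =
  Signed.∣m+n∣n⇒∣m (subst (c Signed.∣_) (coeff-∷-*ₚ a f g j) c∣fg)
    (∣*ₚ f g j (λ i′ j′ eq → others (suc i′) j′ (cong suc eq) λ ()))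
∣*ₚ⇒∣term {c} (a ∷ f) g (suc i) j       others c∣fg =
  ∣*ₚ⇒∣term f g i j (λ i′ j′ eq i′≢i → others (suc i′) j′ (cong suc eq) (i′≢i ∘ ℕ.suc-injective))
    (Signed.∣m+n∣m⇒∣n (subst (c Signed.∣_) (coeff-∷-*ₚ a f g (i ℕ.+ j)) c∣fg) (others 0 (suc i ℕ.+ j) refl λ ()))

∤*ₚ⇒∤terms : ∀ c f g n → ¬ (c Signed.∣ coeff (f *ₚ g) n) →
  ∃[ i ] ∃[ j ] i ℕ.+ j ≡ n × ¬ (c Signed.∣ coeff f i) × ¬ (c Signed.∣ coeff g j)
∤*ₚ⇒∤terms c []      g n       c∤fg = contradiction (Signed.∣ᵤ⇒∣ (∣ c ∣ ℕ.∣0)) c∤fg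
∤*ₚ⇒∤terms c (a ∷ f) g zero    c∤fg =
  0 , 0 , refl , (λ c∣a → c∤ag (Signed.∣m⇒∣m*n (coeff g 0) c∣a)) , λ c∣b → c∤ag (Signed.∣n⇒∣m*n a c∣b)
  where
  c∤ag : ¬ (c Signed.∣ a ℤ.* coeff g 0)
  c∤ag = c∤fg ∘ subst (c Signed.∣_) (sym (coeff-*ₚ-zero (a ∷ f) g))
∤*ₚ⇒∤terms c (a ∷ f) g (suc n) c∤fg with c Signed.∣? a ℤ.* coeff g (suc n)
... | no  c∤ag = 0 , suc n , refl , (λ c∣a → c∤ag (Signed.∣m⇒∣m*n (coeff g (suc n)) c∣a)) , λ c∣b → c∤ag (Signed.∣n⇒∣m*n a c∣b)
... | yes c∣ag with ∤*ₚ⇒∤terms c f g n (λ c∣rest →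
      c∤fg (subst (c Signed.∣_) (sym (coeff-∷-*ₚ a f g n)) (Signed.∣m∣n⇒∣m+n c∣ag c∣rest)))
...   | i , j , i+j≡n , c∤fᵢ , c∤gⱼ = suc i , j , cong suc i+j≡n , c∤fᵢ , c∤gⱼ

-- For a prime `p`, the p-adic valuation of `x` is `e`. As a relation it is simply false at x = 0.
Exact : ℕ → ℕ → ℤ → Set
Exact p e x = + (p ℕ.^ e) Signed.∣ x × ¬ (+ (p ℕ.^ suc e) Signed.∣ x)

^-∣ : ∀ p {d e} → d ≤ e → + (p ℕ.^ d) Signed.∣ + (p ℕ.^ e)
^-∣ p {d} {e} d≤e = Signed.∣ᵤ⇒∣ (ℕ.divides (p ℕ.^ (e ℕ.∸ d))
  (trans (cong (p ℕ.^_) (sym (ℕ.m∸n+n≡m d≤e))) (ℕ.^-distribˡ-+-* p (e ℕ.∸ d) d)))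

^-∣-* : ∀ p d e {x y} → + (p ℕ.^ d) Signed.∣ x → + (p ℕ.^ e) Signed.∣ y → + (p ℕ.^ (d ℕ.+ e)) Signed.∣ x ℤ.* y
^-∣-* p d e {x} {y} d∣x e∣y = Signed.∣ᵤ⇒∣ (subst₂ ℕ._∣_
  (sym (ℕ.^-distribˡ-+-* p d e)) (sym (ℤ.abs-* x y)) (ℕ.*-pres-∣ (Signed.∣⇒∣ᵤ d∣x) (Signed.∣⇒∣ᵤ e∣y)))

exact-max : ∀ {p e x d} → Exact p e x → + (p ℕ.^ d) Signed.∣ x → d ≤ e
exact-max {p} {e} {x} {d} (_ , ∤x) d∣x with d ℕ.≤? e
... | yes d≤e = d≤e
... | no  d≰e = contradiction (Signed.∣-trans (^-∣ p (ℕ.≰⇒> d≰e)) d∣x) ∤x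

crossing : ∀ {P : ℕ → Set} → (∀ e → P e ⊎ ¬ P e) → ∀ n → P 0 → ¬ P n → ∃[ e ] P e × ¬ P (suc e)
crossing P? zero    p₀ ¬pₙ = contradiction p₀ ¬pₙ
crossing P? (suc n) p₀ ¬pₙ with P? n
... | inj₁ pₙ  = n , pₙ , ¬pₙ
... | inj₂ ¬p′ = crossing P? n p₀ ¬p′

n<p^n : ∀ p → 1 < p → ∀ n → n < p ℕ.^ n
n<p^n p 1<p zero    = s≤s z≤n
n<p^n p 1<p (suc n) = ℕ.≤-<-trans (n<p^n p 1<p n) (ℕ.^-monoʳ-< p 1<p (ℕ.n<1+n n))

-- The search for the exponent ends by |x|, because |x| < p^|x|.
∃-exact : ∀ {p} → 1 < p → ∀ {x} → x ≢ 0ℤ → ∃[ e ] Exact p e x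
∃-exact {p} 1<p {x} x≢0 = crossing dec ∣ x ∣ (Signed.∣ᵤ⇒∣ (ℕ.1∣ ∣ x ∣)) too-big
  where
  dec : ∀ e → + (p ℕ.^ e) Signed.∣ x ⊎ ¬ (+ (p ℕ.^ e) Signed.∣ x)
  dec e with + (p ℕ.^ e) Signed.∣? x
  ... | yes ∣x = inj₁ ∣x
  ... | no  ∤x = inj₂ ∤x
  too-big : ¬ (+ (p ℕ.^ ∣ x ∣) Signed.∣ x)
  too-big ∣x = ℕ.>⇒∤ {{ℕ.≢-nonZero (x≢0 ∘ ℤ.∣i∣≡0⇒i≡0)}} (n<p^n p 1<p ∣ x ∣) (Signed.∣⇒∣ᵤ ∣x)

-- Euclid's lemma for the cofactors of p^d in x and of p^e in y.
exact-* : ∀ {p} → Prime p → ∀ {d e x y} → Exact p d x → Exact p e y → Exact p (d ℕ.+ e) (x ℤ.* y)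
exact-* {p} pr {d} {e} {x} {y} (d∣x , d∤x) (e∣y , e∤y) =
  ^-∣-* p d e d∣x e∣y , λ de∣xy → absurd (Signed.∣⇒∣ᵤ d∣x) (Signed.∣⇒∣ᵤ e∣y) (Signed.∣⇒∣ᵤ de∣xy)
  where
  absurd : p ℕ.^ d ℕ.∣ ∣ x ∣ → p ℕ.^ e ℕ.∣ ∣ y ∣ → p ℕ.^ suc (d ℕ.+ e) ℕ.∣ ∣ x ℤ.* y ∣ → ⊥
  absurd (ℕ.divides q x≡) (ℕ.divides r y≡) de∣xy
    with euclidsLemma q r pr (ℕ.*-cancelʳ-∣ (p ℕ.^ (d ℕ.+ e)) (subst (p ℕ.^ suc (d ℕ.+ e) ℕ.∣_) xy≡ de∣xy))
    where
    instance
      pᵈᵉ≢0 : ℕ.NonZero (p ℕ.^ (d ℕ.+ e))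
      pᵈᵉ≢0 = ℕ.m^n≢0 p (d ℕ.+ e) {{prime⇒nonZero pr}}
    open ≡-Reasoning
    open +-*-Solver
    xy≡ : ∣ x ℤ.* y ∣ ≡ q ℕ.* r ℕ.* p ℕ.^ (d ℕ.+ e)
    xy≡ = begin
      ∣ x ℤ.* y ∣                              ≡⟨ ℤ.abs-* x y ⟩
      ∣ x ∣ ℕ.* ∣ y ∣                          ≡⟨ cong₂ ℕ._*_ x≡ y≡ ⟩
      q ℕ.* p ℕ.^ d ℕ.* (r ℕ.* p ℕ.^ e)
        ≡⟨ solve 4 (λ q u r v → q :* u :* (r :* v) := q :* r :* (u :* v)) refl q (p ℕ.^ d) r (p ℕ.^ e) ⟩
      q ℕ.* r ℕ.* (p ℕ.^ d ℕ.* p ℕ.^ e)        ≡⟨ cong (q ℕ.* r ℕ.*_) (ℕ.^-distribˡ-+-* p d e) ⟨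
      q ℕ.* r ℕ.* p ℕ.^ (d ℕ.+ e)              ∎
  ... | inj₁ p∣q = d∤x (Signed.∣ᵤ⇒∣ (subst (p ℕ.^ suc d ℕ.∣_) (sym x≡) (ℕ.*-monoˡ-∣ (p ℕ.^ d) p∣q)))
  ... | inj₂ p∣r = e∤y (Signed.∣ᵤ⇒∣ (subst (p ℕ.^ suc e ℕ.∣_) (sym y≡) (ℕ.*-monoˡ-∣ (p ℕ.^ e) p∣r)))

module NewtonPolygon {p} (pr : Prime p) (k ℓ : ℕ) .{{_ : ℕ.NonZero ℓ}} where

  -- The functional on the (index, exponent) plane that is constant on the segment from (0 , k) to (ℓ , 0).
  height : ℕ → ℕ → ℕ
  height i e = ℓ ℕ.* e ℕ.+ k ℕ.* i

  height-+ : ∀ i e j d → height (i ℕ.+ j) (e ℕ.+ d) ≡ height i e ℕ.+ height j d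
  height-+ i e j d = solve 6
    (λ ℓ k i e j d → ℓ :* (e :+ d) :+ k :* (i :+ j) := (ℓ :* e :+ k :* i) :+ (ℓ :* d :+ k :* j)) refl ℓ k i e j d
    where open +-*-Solver

  height-suc : ∀ i e → height (suc i) e ≡ k ℕ.+ height i e
  height-suc i e = solve 4 (λ ℓ k i e → ℓ :* e :+ k :* (con 1 :+ i) := k :+ (ℓ :* e :+ k :* i)) refl ℓ k i e
    where open +-*-Solver

  height-suc-≤ : ∀ i e j d → height i e ≤ height j d → height (suc i) e ≤ height (suc j) d
  height-suc-≤ i e j d le = subst₂ _≤_ (sym (height-suc i e)) (sym (height-suc j d)) (ℕ.+-monoʳ-≤ k le)

  height-suc-< : ∀ i e j d → height i e < height j d → height (suc i) e < height (suc j) d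
  height-suc-< i e j d lt = subst₂ _<_ (sym (height-suc i e)) (sym (height-suc j d)) (ℕ.+-monoʳ-< k lt)

  height-cancel-< : ∀ i {d e} → height i d < height i e → d < e
  height-cancel-< i {d} {e} lt = ℕ.*-cancelˡ-< ℓ d e (ℕ.+-cancelʳ-< (k ℕ.* i) (ℓ ℕ.* d) (ℓ ℕ.* e) lt)

  1<p : 1 < p
  1<p = ℕ.nonTrivial⇒n>1 p {{prime⇒nonTrivial pr}}

  -- (i , e) is the leftmost lowest point of the Newton polygon of f with respect to height.
  Lowest : Polynomial → ℕ → ℕ → Set
  Lowest f i e = Exact p e (coeff f i) × (∀ j → ∃[ d ] + (p ℕ.^ d) Signed.∣ coeff f j ×
    height i e ≤ height j d × (j < i → height i e < height j d))

  lowest-≤ : ∀ {f i e} → Lowest f i e → ∀ {j d} → Exact p d (coeff f j) → height i e ≤ height j d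
  lowest-≤ {f} {i} {e} (_ , low) {j} {d} ex with low j
  ... | d′ , d′∣ , ≤d′ , _ = ℕ.≤-trans ≤d′ (ℕ.+-monoˡ-≤ (k ℕ.* j) (ℕ.*-monoʳ-≤ ℓ (exact-max {p} {d} {coeff f j} {d′} ex d′∣)))

  -- Zero has no exact exponent but is divisible by every power of `p`. As ℓ ≥ 1, the exponent B + 1
  -- already lifts it above height `B`.
  divisible-above : ∀ {x} B j → x ≡ 0ℤ → ∃[ d ] + (p ℕ.^ d) Signed.∣ x × B ≤ height j d × B < height j d
  divisible-above B j refl = suc B , Signed.∣ᵤ⇒∣ (_ ℕ.∣0) , ℕ.<⇒≤ B< , B<
    where
    B< : B < height j (suc B)
    B< = ℕ.≤-trans (ℕ.m≤n*m (suc B) ℓ) (ℕ.m≤m+n _ (k ℕ.* j))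

  -- Prepending a coefficient raises all old heights by `k` and keeps their order, so only the new
  -- point has to be compared with the old minimum. A tie goes to index 0, which keeps the chosen
  -- point leftmost.
  ∃-lowest : ∀ f → (∀ i → coeff f i ≡ 0ℤ) ⊎ (∃[ i ] ∃[ e ] Lowest f i e)
  ∃-lowest []      = inj₁ (λ _ → refl)
  ∃-lowest (a ∷ f) with a ℤ.≟ 0ℤ | ∃-lowest f
  ... | yes a≡0 | inj₁ f≈0 = inj₁ λ { zero → a≡0 ; (suc i) → f≈0 i }
  ... | no  a≢0 | inj₁ f≈0 with ∃-exact 1<p a≢0
  ...   | e , ex = inj₂ (0 , e , ex , λ where
    zero    → e , proj₁ ex , ℕ.≤-refl , λ ()
    (suc j) → let d , d∣ , ≤d , _ = divisible-above (height 0 e) (suc j) (f≈0 j) in d , d∣ , ≤d , λ ())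
  ∃-lowest (a ∷ f) | yes a≡0 | inj₂ (i , e , ex , low) = inj₂ (suc i , e , ex , λ where
    zero    → let d , d∣ , ≤d , <d = divisible-above (height (suc i) e) 0 a≡0 in d , d∣ , ≤d , λ _ → <d
    (suc j) → let d , d∣ , ≤d , <d = low j in d , d∣ , height-suc-≤ i e j d ≤d , λ { (s≤s j<i) → height-suc-< i e j d (<d j<i) })
  ∃-lowest (a ∷ f) | no a≢0 | inj₂ (i , e , ex , low) with ∃-exact 1<p a≢0
  ...   | c , exₐ with height 0 c ℕ.≤? height (suc i) e
  ...     | yes ≤e = inj₂ (0 , c , exₐ , λ where
    zero    → c , proj₁ exₐ , ℕ.≤-refl , λ ()
    (suc j) → let d , d∣ , ≤d , _ = low j in d , d∣ , ℕ.≤-trans ≤e (height-suc-≤ i e j d ≤d) , λ ())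
  ...     | no  ≰e = inj₂ (suc i , e , ex , λ where
    zero    → c , proj₁ exₐ , ℕ.<⇒≤ (ℕ.≰⇒> ≰e) , λ _ → ℕ.≰⇒> ≰e
    (suc j) → let d , d∣ , ≤d , <d = low j in d , d∣ , height-suc-≤ i e j d ≤d , λ { (s≤s j<i) → height-suc-< i e j d (<d j<i) })

  -- As in Gauss's lemma: fᵢ gⱼ is the only term of (f g)ᵢ₊ⱼ at its height.
  lowest-* : ∀ {f g i e j d} → Lowest f i e → Lowest g j d →
    ¬ (+ (p ℕ.^ suc (e ℕ.+ d)) Signed.∣ coeff (f *ₚ g) (i ℕ.+ j))
  lowest-* {f} {g} {i} {e} {j} {d} (exᶠ , lowᶠ) (exᵍ , lowᵍ) ∣fg =
    proj₂ (exact-* pr {e} {d} {coeff f i} {coeff g j} exᶠ exᵍ) (∣*ₚ⇒∣term f g i j others ∣fg)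
    where
    others : ∀ i′ j′ → i′ ℕ.+ j′ ≡ i ℕ.+ j → i′ ≢ i → + (p ℕ.^ suc (e ℕ.+ d)) Signed.∣ coeff f i′ ℤ.* coeff g j′
    others i′ j′ eq i′≢i with lowᶠ i′ | lowᵍ j′
    ... | e′ , e′∣ , ≤e′ , <e′ | d′ , d′∣ , ≤d′ , <d′ =
      Signed.∣-trans (^-∣ p (height-cancel-< (i ℕ.+ j) higher)) (^-∣-* p e′ d′ e′∣ d′∣)
      where
      -- If i′ ≠ i, then i′ < i or j′ < j, and to the left of a leftmost lowest point all heights
      -- are strictly larger.
      sum< : height i e ℕ.+ height j d < height i′ e′ ℕ.+ height j′ d′
      sum< with ℕ.<-cmp i′ i
      ... | tri< i′<i _ _ = ℕ.+-mono-<-≤ (<e′ i′<i) ≤d′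
      ... | tri≈ _ i′≡i _ = contradiction i′≡i i′≢i
      ... | tri> _ _ i<i′ = ℕ.+-mono-≤-< ≤e′ (<d′ (ℕ.+-cancelˡ-< i′ j′ j
        (subst (_< i′ ℕ.+ j) (sym eq) (ℕ.+-monoˡ-< j i<i′))))
      higher : height (i ℕ.+ j) (e ℕ.+ d) < height (i ℕ.+ j) (e′ ℕ.+ d′)
      higher = subst₂ _<_ (sym (height-+ i e j d))
        (trans (sym (height-+ i′ e′ j′ d′)) (cong (λ x → height x (e′ ℕ.+ d′)) eq)) sum<

  -- Choose s + t = ℓ with p dividing neither fₛ nor gₜ, and let a, b be the valuations of f₀, g₀,
  -- so that a + b ≤ k. Comparing the points (s , 0), (0 , a) of f and (t , 0), (0 , b) of g with
  -- the lowest points gives k s = ℓ a, so ℓ divides s by coprimality. But p divides f₀ and g₀,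
  -- which forces 0 < s < ℓ.
  one-unit-constant : ∀ f g → Coprime ℓ k →
    (∀ i → i < ℓ → + (p ℕ.^ k) Signed.∣ coeff (f *ₚ g) i) →
    ¬ (+ p Signed.∣ coeff (f *ₚ g) ℓ) →
    ¬ (+ (p ℕ.^ suc k) Signed.∣ coeff (f *ₚ g) 0) →
    + p Signed.∣ coeff f 0 → + p Signed.∣ coeff g 0 → ⊥
  one-unit-constant f g cop pᵏ∣ p∤ pᵏ⁺¹∤ p∣f₀ p∣g₀
    with ∤*ₚ⇒∤terms (+ p) f g ℓ p∤ | ∃-lowest f | ∃-lowest g
  ... | s , t , s+t≡ℓ , p∤fₛ , p∤gₜ | inj₁ f≈0 | _ = p∤fₛ (subst (+ p Signed.∣_) (sym (f≈0 s)) (Signed.∣ᵤ⇒∣ (p ℕ.∣0)))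
  ... | s , t , s+t≡ℓ , p∤fₛ , p∤gₜ | _ | inj₁ g≈0 = p∤gₜ (subst (+ p Signed.∣_) (sym (g≈0 t)) (Signed.∣ᵤ⇒∣ (p ℕ.∣0)))
  ... | s , t , s+t≡ℓ , p∤fₛ , p∤gₜ | inj₂ (i , e , lowᶠ) | inj₂ (j , d , lowᵍ) = ℓ≰s (ℕ.∣⇒≤ {{s≢0}} ℓ∣s)
    where
    open ℕ.≤-Reasoning
    f₀g₀≡ = coeff-*ₚ-zero f g
    pᵏ⁺¹∤f₀g₀ : ¬ (+ (p ℕ.^ suc k) Signed.∣ coeff f 0 ℤ.* coeff g 0)
    pᵏ⁺¹∤f₀g₀ = pᵏ⁺¹∤ ∘ subst (+ (p ℕ.^ suc k) Signed.∣_) (sym f₀g₀≡)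
    f₀≢0 : coeff f 0 ≢ 0ℤ
    f₀≢0 f₀≡0 = pᵏ⁺¹∤f₀g₀ (subst (λ x → _ Signed.∣ x ℤ.* coeff g 0) (sym f₀≡0) (Signed.∣ᵤ⇒∣ (_ ℕ.∣0)))
    g₀≢0 : coeff g 0 ≢ 0ℤ
    g₀≢0 g₀≡0 = pᵏ⁺¹∤f₀g₀ (subst (+ (p ℕ.^ suc k) Signed.∣_)
      (sym (trans (cong (coeff f 0 ℤ.*_) g₀≡0) (ℤ.*-zeroʳ (coeff f 0)))) (Signed.∣ᵤ⇒∣ (_ ℕ.∣0)))
    a = proj₁ (∃-exact 1<p f₀≢0)
    exᵃ = proj₂ (∃-exact 1<p f₀≢0)
    b = proj₁ (∃-exact 1<p g₀≢0)
    exᵇ = proj₂ (∃-exact 1<p g₀≢0)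
    unit : ∀ {x} → ¬ (+ p Signed.∣ x) → Exact p 0 x
    unit {x} p∤x = Signed.∣ᵤ⇒∣ (ℕ.1∣ ∣ x ∣) , p∤x ∘ subst (λ q → + q Signed.∣ x) (ℕ.*-identityʳ p)
    a+b≤k : a ℕ.+ b ≤ k
    a+b≤k = ℕ.≮⇒≥ λ k<a+b → pᵏ⁺¹∤f₀g₀ (Signed.∣-trans (^-∣ p k<a+b) (^-∣-* p a b (proj₁ exᵃ) (proj₁ exᵇ)))
    -- No point of the product lies below the segment. For i + j < ℓ the divisibility by p^k forces
    -- e + d ≥ k through `lowest-*`; otherwise the index alone gives the height.
    kℓ≤ : k ℕ.* ℓ ≤ height i e ℕ.+ height j d
    kℓ≤ with i ℕ.+ j ℕ.<? ℓ
    ... | yes i+j<ℓ = begin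
      k ℕ.* ℓ                            ≡⟨ ℕ.*-comm k ℓ ⟩
      ℓ ℕ.* k
        ≤⟨ ℕ.*-monoʳ-≤ ℓ (ℕ.≮⇒≥ λ e+d<k → lowest-* {f} {g} lowᶠ lowᵍ (Signed.∣-trans (^-∣ p e+d<k) (pᵏ∣ (i ℕ.+ j) i+j<ℓ))) ⟩
      ℓ ℕ.* (e ℕ.+ d)                    ≤⟨ ℕ.m≤m+n _ _ ⟩
      height (i ℕ.+ j) (e ℕ.+ d)         ≡⟨ height-+ i e j d ⟩
      height i e ℕ.+ height j d          ∎
    ... | no  i+j≮ℓ = begin
      k ℕ.* ℓ                            ≤⟨ ℕ.*-monoʳ-≤ k (ℕ.≮⇒≥ i+j≮ℓ) ⟩
      k ℕ.* (i ℕ.+ j)                    ≤⟨ ℕ.m≤n+m _ _ ⟩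
      height (i ℕ.+ j) (e ℕ.+ d)         ≡⟨ height-+ i e j d ⟩
      height i e ℕ.+ height j d          ∎
    -- Bound the minimum for `f` by the point (0 , a) and that for `g` by (t , 0); the reverse
    -- inequality uses (s , 0) and (0 , b).
    ks≤ℓa : k ℕ.* s ≤ ℓ ℕ.* a
    ks≤ℓa = ℕ.+-cancelʳ-≤ (k ℕ.* t) _ _ (begin
      k ℕ.* s ℕ.+ k ℕ.* t                ≡⟨ ℕ.*-distribˡ-+ k s t ⟨
      k ℕ.* (s ℕ.+ t)                    ≡⟨ cong (k ℕ.*_) s+t≡ℓ ⟩
      k ℕ.* ℓ                            ≤⟨ kℓ≤ ⟩
      height i e ℕ.+ height j d          ≤⟨ ℕ.+-mono-≤ (lowest-≤ {f} lowᶠ exᵃ) (lowest-≤ {g} lowᵍ (unit p∤gₜ)) ⟩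
      height 0 a ℕ.+ height t 0
        ≡⟨ solve 4 (λ ℓ a k t → (ℓ :* a :+ k :* con 0) :+ (ℓ :* con 0 :+ k :* t) := ℓ :* a :+ k :* t) refl ℓ a k t ⟩
      ℓ ℕ.* a ℕ.+ k ℕ.* t                ∎)
      where open +-*-Solver
    ℓa≤ks : ℓ ℕ.* a ≤ k ℕ.* s
    ℓa≤ks = ℕ.+-cancelʳ-≤ (ℓ ℕ.* b) _ _ (begin
      ℓ ℕ.* a ℕ.+ ℓ ℕ.* b                ≡⟨ ℕ.*-distribˡ-+ ℓ a b ⟨
      ℓ ℕ.* (a ℕ.+ b)                    ≤⟨ ℕ.*-monoʳ-≤ ℓ a+b≤k ⟩
      ℓ ℕ.* k                            ≡⟨ ℕ.*-comm ℓ k ⟩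
      k ℕ.* ℓ                            ≤⟨ kℓ≤ ⟩
      height i e ℕ.+ height j d          ≤⟨ ℕ.+-mono-≤ (lowest-≤ {f} lowᶠ (unit p∤fₛ)) (lowest-≤ {g} lowᵍ exᵇ) ⟩
      height s 0 ℕ.+ height 0 b
        ≡⟨ solve 4 (λ ℓ b k s → (ℓ :* con 0 :+ k :* s) :+ (ℓ :* b :+ k :* con 0) := k :* s :+ ℓ :* b) refl ℓ b k s ⟩
      k ℕ.* s ℕ.+ ℓ ℕ.* b                ∎)
      where open +-*-Solver
    ℓ∣s : ℓ ℕ.∣ s
    ℓ∣s = Coprimality.coprime-divisor cop (subst (ℓ ℕ.∣_) (ℕ.≤-antisym ℓa≤ks ks≤ℓa) (ℕ.m∣m*n a))
    s≢0 : ℕ.NonZero s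
    s≢0 = ℕ.≢-nonZero λ s≡0 → p∤fₛ (subst (λ x → + p Signed.∣ coeff f x) (sym s≡0) p∣f₀)
    t≢0 : t ≢ 0
    t≢0 t≡0 = p∤gₜ (subst (λ x → + p Signed.∣ coeff g x) (sym t≡0) p∣g₀)
    ℓ≰s : ¬ (ℓ ≤ s)
    ℓ≰s ℓ≤s = ℕ.<-irrefl refl (begin-strict
      ℓ           ≤⟨ ℓ≤s ⟩
      s           <⟨ ℕ.m<m+n s (ℕ.n≢0⇒n>0 t≢0) ⟩
      s ℕ.+ t     ≡⟨ s+t≡ℓ ⟩
      ℓ           ∎)

-- From the real α to the integer n − d

ι : ℕ → ℚ
ι n = + n ℚ./ 1

-- Passing to unnormalised fractions with denominator 1 reduces this to integers.
ι-+ : ∀ m n → ι (m ℕ.+ n) ≡ ι m ℚ.+ ι n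
ι-+ m n = ℚ.toℚᵘ-injective (begin
  ℚ.toℚᵘ (ι (m ℕ.+ n))                   ≈⟨ ℚ.toℚᵘ-fromℚᵘ (mkℚᵘ (+ (m ℕ.+ n)) 0) ⟩
  mkℚᵘ (+ (m ℕ.+ n)) 0
    ≈⟨ ℚᵘ.*≡* (cong (ℤ._* 1ℤ) (cong₂ ℤ._+_ (sym (ℤ.*-identityʳ (+ m))) (sym (ℤ.*-identityʳ (+ n))))) ⟩
  mkℚᵘ (+ m) 0 ℚᵘ.+ mkℚᵘ (+ n) 0         ≈⟨ ℚᵘ.+-cong (ℚ.toℚᵘ-fromℚᵘ (mkℚᵘ (+ m) 0)) (ℚ.toℚᵘ-fromℚᵘ (mkℚᵘ (+ n) 0)) ⟨
  ℚ.toℚᵘ (ι m) ℚᵘ.+ ℚ.toℚᵘ (ι n)         ≈⟨ ℚ.toℚᵘ-homo-+ (ι m) (ι n) ⟨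
  ℚ.toℚᵘ (ι m ℚ.+ ι n)                   ∎)
  where open ℚᵘ.≃-Reasoning

ι-* : ∀ m n → ι (m ℕ.* n) ≡ ι m ℚ.* ι n
ι-* m n = ℚ.toℚᵘ-injective (begin
  ℚ.toℚᵘ (ι (m ℕ.* n))                   ≈⟨ ℚ.toℚᵘ-fromℚᵘ (mkℚᵘ (+ (m ℕ.* n)) 0) ⟩
  mkℚᵘ (+ (m ℕ.* n)) 0                   ≈⟨ ℚᵘ.*≡* (cong (ℤ._* 1ℤ) (ℤ.pos-* m n)) ⟩
  mkℚᵘ (+ m) 0 ℚᵘ.* mkℚᵘ (+ n) 0         ≈⟨ ℚᵘ.*-cong (ℚ.toℚᵘ-fromℚᵘ (mkℚᵘ (+ m) 0)) (ℚ.toℚᵘ-fromℚᵘ (mkℚᵘ (+ n) 0)) ⟨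
  ℚ.toℚᵘ (ι m) ℚᵘ.* ℚ.toℚᵘ (ι n)         ≈⟨ ℚ.toℚᵘ-homo-* (ι m) (ι n) ⟨
  ℚ.toℚᵘ (ι m ℚ.* ι n)                   ∎)
  where open ℚᵘ.≃-Reasoning

ι-^ : ∀ m n → ι (m ℕ.^ n) ≡ ι m ^ n
ι-^ m zero    = refl
ι-^ m (suc n) = trans (ι-* m (m ℕ.^ n)) (cong (ι m ℚ.*_) (ι-^ m n))

0≤ι : ∀ n → 0ℚ ℚ.≤ ι n
0≤ι n = ℚ.nonNegative⁻¹ (ι n) {{ℚ.normalize-nonNeg n 1}}

0<ι : ∀ n .{{_ : ℕ.NonZero n}} → 0ℚ ℚ.< ι n
0<ι n = ℚ.positive⁻¹ (ι n) {{ℚ.normalize-pos n 1}}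

ι-mono-≤ : ∀ {m n} → m ≤ n → ι m ℚ.≤ ι n
ι-mono-≤ {m} {n} m≤n = begin
  ι m                      ≡⟨ ℚ.+-identityʳ (ι m) ⟨
  ι m ℚ.+ 0ℚ               ≤⟨ ℚ.+-monoʳ-≤ (ι m) (0≤ι (n ℕ.∸ m)) ⟩
  ι m ℚ.+ ι (n ℕ.∸ m)      ≡⟨ ι-+ m (n ℕ.∸ m) ⟨
  ι (m ℕ.+ (n ℕ.∸ m))      ≡⟨ cong ι (ℕ.m+[n∸m]≡n m≤n) ⟩
  ι n                      ∎
  where open ℚ.≤-Reasoning

ι-sum : ∀ {m} (u : Vector ℕ m) → ι (sumℕ u) ≡ sumℚ (ι ∘ u)
ι-sum {zero}  u = refl
ι-sum {suc m} u = trans (ι-+ (u Fin.zero) _) (cong (ι (u Fin.zero) ℚ.+_) (ι-sum (u ∘ Fin.suc)))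

*-monoˡ : ∀ {r p q} → 0ℚ ℚ.≤ r → p ℚ.≤ q → r ℚ.* p ℚ.≤ r ℚ.* q
*-monoˡ {r} 0≤r = ℚ.*-monoˡ-≤-nonNeg r {{ℚ.nonNegative 0≤r}}

*-mono : ∀ {p q r s} → 0ℚ ℚ.≤ r → 0ℚ ℚ.≤ q → p ℚ.≤ q → r ℚ.≤ s → p ℚ.* r ℚ.≤ q ℚ.* s
*-mono {r = r} 0≤r 0≤q p≤q r≤s = ℚ.≤-trans (ℚ.*-monoʳ-≤-nonNeg r {{ℚ.nonNegative 0≤r}} p≤q) (*-monoˡ 0≤q r≤s)

0≤p*q : ∀ {p q} → 0ℚ ℚ.≤ p → 0ℚ ℚ.≤ q → 0ℚ ℚ.≤ p ℚ.* q
0≤p*q {p} {q} 0≤p 0≤q = ℚ.nonNegative⁻¹ (p ℚ.* q)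
  {{ℚ.nonNeg*nonNeg⇒nonNeg p {{ℚ.nonNegative 0≤p}} q {{ℚ.nonNegative 0≤q}}}}

0<p*q : ∀ {p q} → 0ℚ ℚ.< p → 0ℚ ℚ.< q → 0ℚ ℚ.< p ℚ.* q
0<p*q {p} {q} 0<p 0<q = subst (ℚ._< p ℚ.* q) (ℚ.*-zeroʳ p) (ℚ.*-monoʳ-<-pos p {{ℚ.positive 0<p}} 0<q)

0<p^n : ∀ {p} → 0ℚ ℚ.< p → ∀ n → 0ℚ ℚ.< p ^ n
0<p^n 0<p zero    = ℚ.positive⁻¹ 1ℚ
0<p^n 0<p (suc n) = 0<p*q 0<p (0<p^n 0<p n)

0≤p^n : ∀ {p} → 0ℚ ℚ.< p → ∀ n → 0ℚ ℚ.≤ p ^ n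
0≤p^n 0<p n = ℚ.<⇒≤ (0<p^n 0<p n)

^-mono-≤ : ∀ {x y} → 0ℚ ℚ.< x → x ℚ.≤ y → ∀ n → x ^ n ℚ.≤ y ^ n
^-mono-≤ 0<x x≤y zero    = ℚ.≤-refl
^-mono-≤ 0<x x≤y (suc n) = *-mono (0≤p^n 0<x n) (ℚ.≤-trans (ℚ.<⇒≤ 0<x) x≤y) x≤y (^-mono-≤ 0<x x≤y n)

-- As y / x ≤ 1, its powers decrease with the exponent; the form avoids division.
^-cross-≤ : ∀ {y x} → 0ℚ ℚ.< y → y ℚ.≤ x → ∀ {i m} → i ≤ m → y ^ m ℚ.* x ^ i ℚ.≤ x ^ m ℚ.* y ^ i
^-cross-≤ 0<y y≤x {m = m} z≤n = ℚ.*-monoʳ-≤-nonNeg 1ℚ (^-mono-≤ 0<y y≤x m)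
^-cross-≤ {y} {x} 0<y y≤x {suc i} {suc m} (s≤s i≤m) = begin
  y ℚ.* y ^ m ℚ.* (x ℚ.* x ^ i)     ≡⟨ regroup y (y ^ m) x (x ^ i) ⟩
  x ℚ.* y ℚ.* (y ^ m ℚ.* x ^ i)     ≤⟨ *-monoˡ (0≤p*q 0≤x (ℚ.<⇒≤ 0<y)) (^-cross-≤ 0<y y≤x i≤m) ⟩
  x ℚ.* y ℚ.* (x ^ m ℚ.* y ^ i)     ≡⟨ cong (ℚ._* (x ^ m ℚ.* y ^ i)) (ℚ.*-comm x y) ⟩
  y ℚ.* x ℚ.* (x ^ m ℚ.* y ^ i)     ≡⟨ regroup x (x ^ m) y (y ^ i) ⟨
  x ℚ.* x ^ m ℚ.* (y ℚ.* y ^ i)     ∎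
  where
  open ℚ.≤-Reasoning
  0≤x = ℚ.≤-trans (ℚ.<⇒≤ 0<y) y≤x
  regroup : ∀ a b c d → a ℚ.* b ℚ.* (c ℚ.* d) ≡ c ℚ.* a ℚ.* (b ℚ.* d)
  regroup = solve 4 (λ a b c d → a :* b :* (c :* d) := c :* a :* (b :* d)) refl
    where open ℚ.+-*-Solver

-- A Lipschitz bound on [x , x + 1]. In the step z ≤ 1 absorbs the quadratic term, so the constant
-- passes from L to x^m + L (x + 1).
^-lipschitz : ∀ {x} → 0ℚ ℚ.< x → ∀ m → ∃[ L ] 0ℚ ℚ.≤ L ×
  (∀ z → 0ℚ ℚ.≤ z → z ℚ.≤ 1ℚ → (x ℚ.+ z) ^ m ℚ.≤ x ^ m ℚ.+ L ℚ.* z)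
^-lipschitz {x} 0<x zero    = 0ℚ , ℚ.≤-refl , λ z _ _ →
  ℚ.≤-reflexive (sym (trans (cong (1ℚ ℚ.+_) (ℚ.*-zeroˡ z)) (ℚ.+-identityʳ 1ℚ)))
^-lipschitz {x} 0<x (suc m) with ^-lipschitz 0<x m
... | L , 0≤L , bound = x ^ m ℚ.+ L ℚ.* (x ℚ.+ 1ℚ)
  , ℚ.+-mono-≤ (0≤p^n 0<x m) (0≤p*q 0≤L (ℚ.+-mono-≤ 0≤x (ℚ.nonNegative⁻¹ 1ℚ)))
  , λ z 0≤z z≤1 → begin
    (x ℚ.+ z) ℚ.* (x ℚ.+ z) ^ m                               ≤⟨ *-monoˡ (ℚ.+-mono-≤ 0≤x 0≤z) (bound z 0≤z z≤1) ⟩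
    (x ℚ.+ z) ℚ.* (x ^ m ℚ.+ L ℚ.* z)                         ≡⟨ expand x z (x ^ m) L ⟩
    x ℚ.* x ^ m ℚ.+ z ℚ.* (x ^ m ℚ.+ L ℚ.* (x ℚ.+ z))
      ≤⟨ ℚ.+-monoʳ-≤ (x ℚ.* x ^ m) (*-monoˡ 0≤z (ℚ.+-monoʳ-≤ (x ^ m) (*-monoˡ 0≤L (ℚ.+-monoʳ-≤ x z≤1)))) ⟩
    x ℚ.* x ^ m ℚ.+ z ℚ.* (x ^ m ℚ.+ L ℚ.* (x ℚ.+ 1ℚ))        ≡⟨ cong (x ℚ.* x ^ m ℚ.+_) (ℚ.*-comm z _) ⟩
    x ℚ.* x ^ m ℚ.+ (x ^ m ℚ.+ L ℚ.* (x ℚ.+ 1ℚ)) ℚ.* z        ∎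
  where
  open ℚ.≤-Reasoning
  0≤x = ℚ.<⇒≤ 0<x
  expand : ∀ x z p L → (x ℚ.+ z) ℚ.* (p ℚ.+ L ℚ.* z) ≡ x ℚ.* p ℚ.+ z ℚ.* (p ℚ.+ L ℚ.* (x ℚ.+ z))
  expand = solve 4 (λ x z p L → (x :+ z) :* (p :+ L :* z) := x :* p :+ z :* (p :+ L :* (x :+ z))) refl
    where open ℚ.+-*-Solver

sumℚ-mono : ∀ {m} (u v : Vector ℚ m) → (∀ i → u i ℚ.≤ v i) → sumℚ u ℚ.≤ sumℚ v
sumℚ-mono {zero}  u v u≤v = ℚ.≤-refl
sumℚ-mono {suc m} u v u≤v = ℚ.+-mono-≤ (u≤v Fin.zero) (sumℚ-mono (u ∘ Fin.suc) (v ∘ Fin.suc) (u≤v ∘ Fin.suc))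

sumℚ-cong : ∀ {m} (u v : Vector ℚ m) → (∀ i → u i ≡ v i) → sumℚ u ≡ sumℚ v
sumℚ-cong {zero}  u v u≗v = refl
sumℚ-cong {suc m} u v u≗v = cong₂ ℚ._+_ (u≗v Fin.zero) (sumℚ-cong (u ∘ Fin.suc) (v ∘ Fin.suc) (u≗v ∘ Fin.suc))

*-distribˡ-sumℚ : ∀ {m} c (u : Vector ℚ m) → c ℚ.* sumℚ u ≡ sumℚ (λ i → c ℚ.* u i)
*-distribˡ-sumℚ {zero}  c u = ℚ.*-zeroʳ c
*-distribˡ-sumℚ {suc m} c u =
  trans (ℚ.*-distribˡ-+ c (u Fin.zero) _) (cong (c ℚ.* u Fin.zero ℚ.+_) (*-distribˡ-sumℚ c (u ∘ Fin.suc)))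

-- The choice δ = ε / (K + ε) meets both bounds at once.
small : ∀ {K ε} → 0ℚ ℚ.≤ K → 0ℚ ℚ.< ε → ∃[ δ ] 0ℚ ℚ.< δ × δ ℚ.≤ 1ℚ × K ℚ.* δ ℚ.< ε
small {K} {ε} 0≤K 0<ε = δ , 0<δ , δ≤1 , (begin-strict
  K ℚ.* δ          <⟨ ℚ.*-monoˡ-<-pos δ {{ℚ.positive 0<δ}} K<D ⟩
  D ℚ.* δ          ≡⟨ Dδ≡ε ⟩
  ε                ∎)
  where
  open ℚ.≤-Reasoning
  D = K ℚ.+ ε
  K<D : K ℚ.< D
  K<D = subst (ℚ._< D) (ℚ.+-identityʳ K) (ℚ.+-monoʳ-< K 0<ε)
  ε≤D : ε ℚ.≤ D
  ε≤D = subst (ℚ._≤ D) (ℚ.+-identityˡ ε) (ℚ.+-monoˡ-≤ ε 0≤K)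
  instance
    D⁺ : ℚ.Positive D
    D⁺ = ℚ.positive (ℚ.<-≤-trans 0<ε ε≤D)
    D≢0 : ℚ.NonZero D
    D≢0 = ℚ.pos⇒nonZero D
  δ = (ℚ.1/ D) ℚ.* ε
  0<δ : 0ℚ ℚ.< δ
  0<δ = 0<p*q (ℚ.positive⁻¹ (ℚ.1/ D) {{ℚ.1/pos⇒pos D}}) 0<ε
  Dδ≡ε : D ℚ.* δ ≡ ε
  Dδ≡ε = trans (sym (ℚ.*-assoc D (ℚ.1/ D) ε)) (trans (cong (ℚ._* ε) (ℚ.*-inverseʳ D)) (ℚ.*-identityˡ ε))
  δ≤1 : δ ℚ.≤ 1ℚ
  δ≤1 = ℚ.*-cancelˡ-≤-pos D (subst₂ ℚ._≤_ (sym Dδ≡ε) (sym (ℚ.*-identityʳ D)) ε≤D)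

-- Σ wᵢ xⁱ⁻ᵐ decreases in x, so the points where A dominates lie to the right of x, and by continuity not close to x.
dominance-gap : ∀ {m} (w : Vector ℚ m) {A ε x} → (∀ i → 0ℚ ℚ.≤ w i) → 0ℚ ℚ.≤ A → 0ℚ ℚ.< ε → 0ℚ ℚ.< x →
  A ℚ.* x ^ m ℚ.≤ sumℚ (λ i → w i ℚ.* x ^ toℕ i) →
  ∃[ δ ] 0ℚ ℚ.< δ × (∀ y → 0ℚ ℚ.< y → sumℚ (λ i → w i ℚ.* y ^ toℕ i) ℚ.+ ε ℚ.≤ A ℚ.* y ^ m → x ℚ.+ δ ℚ.≤ y)
dominance-gap {m} w {A} {ε} {x} 0≤w 0≤A 0<ε 0<x not-dom = δ , 0<δ , gap
  where
  open ℚ.≤-Reasoning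
  L = proj₁ (^-lipschitz 0<x m)
  0≤L = proj₁ (proj₂ (^-lipschitz 0<x m))
  lipschitz = proj₂ (proj₂ (^-lipschitz 0<x m))
  K = A ℚ.* L
  0≤K = 0≤p*q 0≤A 0≤L
  δ = proj₁ (small 0≤K 0<ε)
  0<δ = proj₁ (proj₂ (small 0≤K 0<ε))
  δ≤1 = proj₁ (proj₂ (proj₂ (small 0≤K 0<ε)))
  Kδ<ε = proj₂ (proj₂ (proj₂ (small 0≤K 0<ε)))
  Σw : ℚ → ℚ
  Σw y = sumℚ (λ i → w i ℚ.* y ^ toℕ i)

  -- Dominance at some y ≤ x would carry over to `x`: after scaling by xᵐ and yᵐ the sums are
  -- compared term by term with `^-cross-≤`.
  left : ∀ y → 0ℚ ℚ.< y → y ℚ.≤ x → ¬ (Σw y ℚ.+ ε ℚ.≤ A ℚ.* y ^ m)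
  left y 0<y y≤x dom = ℚ.<-irrefl refl (begin-strict
    y ^ m ℚ.* (A ℚ.* x ^ m)                            ≤⟨ *-monoˡ (0≤p^n 0<y m) not-dom ⟩
    y ^ m ℚ.* Σw x                                     ≡⟨ *-distribˡ-sumℚ (y ^ m) (λ i → w i ℚ.* x ^ toℕ i) ⟩
    sumℚ (λ i → y ^ m ℚ.* (w i ℚ.* x ^ toℕ i))
      ≤⟨ sumℚ-mono (λ i → y ^ m ℚ.* (w i ℚ.* x ^ toℕ i)) (λ i → x ^ m ℚ.* (w i ℚ.* y ^ toℕ i)) term ⟩
    sumℚ (λ i → x ^ m ℚ.* (w i ℚ.* y ^ toℕ i))         ≡⟨ *-distribˡ-sumℚ (x ^ m) (λ i → w i ℚ.* y ^ toℕ i) ⟨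
    x ^ m ℚ.* Σw y
      <⟨ ℚ.*-monoʳ-<-pos (x ^ m) {{ℚ.positive (0<p^n 0<x m)}} (subst (ℚ._< Σw y ℚ.+ ε) (ℚ.+-identityʳ (Σw y)) (ℚ.+-monoʳ-< (Σw y) 0<ε)) ⟩
    x ^ m ℚ.* (Σw y ℚ.+ ε)                             ≤⟨ *-monoˡ (0≤p^n 0<x m) dom ⟩
    x ^ m ℚ.* (A ℚ.* y ^ m)                            ≡⟨ rotate (x ^ m) A (y ^ m) ⟩
    y ^ m ℚ.* (A ℚ.* x ^ m)                            ∎)
    where
    open ℚ.+-*-Solver using (solve; _:=_; _:*_)
    rotate : ∀ a b c → a ℚ.* (b ℚ.* c) ≡ c ℚ.* (b ℚ.* a)
    rotate = solve 3 (λ a b c → a :* (b :* c) := c :* (b :* a)) refl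
    swap : ∀ a b c → a ℚ.* (b ℚ.* c) ≡ b ℚ.* (a ℚ.* c)
    swap = solve 3 (λ a b c → a :* (b :* c) := b :* (a :* c)) refl
    term : ∀ i → y ^ m ℚ.* (w i ℚ.* x ^ toℕ i) ℚ.≤ x ^ m ℚ.* (w i ℚ.* y ^ toℕ i)
    term i = begin
      y ^ m ℚ.* (w i ℚ.* x ^ toℕ i)     ≡⟨ swap (y ^ m) (w i) (x ^ toℕ i) ⟩
      w i ℚ.* (y ^ m ℚ.* x ^ toℕ i)     ≤⟨ *-monoˡ (0≤w i) (^-cross-≤ 0<y y≤x (ℕ.<⇒≤ (Fin.toℕ<n i))) ⟩
      w i ℚ.* (x ^ m ℚ.* y ^ toℕ i)     ≡⟨ swap (w i) (x ^ m) (y ^ toℕ i) ⟩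
      x ^ m ℚ.* (w i ℚ.* y ^ toℕ i)     ∎

  -- From x to x + z the leading term grows by at most K δ < ε, while the sum does not decrease, so
  -- the margin ε cannot be reached.
  right : ∀ z → 0ℚ ℚ.≤ z → z ℚ.≤ δ → ¬ (Σw (x ℚ.+ z) ℚ.+ ε ℚ.≤ A ℚ.* (x ℚ.+ z) ^ m)
  right z 0≤z z≤δ dom = ℚ.<-irrefl refl (begin-strict
    A ℚ.* (x ℚ.+ z) ^ m                        ≤⟨ *-monoˡ 0≤A (lipschitz z 0≤z (ℚ.≤-trans z≤δ δ≤1)) ⟩
    A ℚ.* (x ^ m ℚ.+ L ℚ.* z)
      ≡⟨ trans (ℚ.*-distribˡ-+ A (x ^ m) (L ℚ.* z)) (cong (A ℚ.* x ^ m ℚ.+_) (sym (ℚ.*-assoc A L z))) ⟩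
    A ℚ.* x ^ m ℚ.+ K ℚ.* z                    ≤⟨ ℚ.+-mono-≤ not-dom (*-monoˡ 0≤K z≤δ) ⟩
    Σw x ℚ.+ K ℚ.* δ                           <⟨ ℚ.+-monoʳ-< (Σw x) Kδ<ε ⟩
    Σw x ℚ.+ ε
      ≤⟨ ℚ.+-monoˡ-≤ ε (sumℚ-mono (λ i → w i ℚ.* x ^ toℕ i) (λ i → w i ℚ.* (x ℚ.+ z) ^ toℕ i) (λ i → *-monoˡ (0≤w i) (^-mono-≤ 0<x x≤x+z (toℕ i)))) ⟩
    Σw (x ℚ.+ z) ℚ.+ ε                         ≤⟨ dom ⟩
    A ℚ.* (x ℚ.+ z) ^ m                        ∎)
    where
    x≤x+z : x ℚ.≤ x ℚ.+ z
    x≤x+z = subst (ℚ._≤ x ℚ.+ z) (ℚ.+-identityʳ x) (ℚ.+-monoʳ-≤ x 0≤z)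

  gap : ∀ y → 0ℚ ℚ.< y → Σw y ℚ.+ ε ℚ.≤ A ℚ.* y ^ m → x ℚ.+ δ ℚ.≤ y
  gap y 0<y dom with x ℚ.+ δ ℚ.≤? y
  ... | yes x+δ≤y = x+δ≤y
  ... | no  x+δ≰y with ℚ.≤-total y x
  ...   | inj₁ y≤x = contradiction dom (left y 0<y y≤x)
  ...   | inj₂ x≤y = contradiction (subst (λ t → Σw t ℚ.+ ε ℚ.≤ A ℚ.* t ^ m) (sym x+z≡y) dom) (right (y ℚ.- x) 0≤z z≤δ)
    where
    open ℚ.+-*-Solver using (solve; _:=_; _:+_; _:-_)
    x+z≡y : x ℚ.+ (y ℚ.- x) ≡ y
    x+z≡y = solve 2 (λ x y → x :+ (y :- x) := y) refl x y
    0≤z : 0ℚ ℚ.≤ y ℚ.- x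
    0≤z = subst (ℚ._≤ y ℚ.- x) (ℚ.+-inverseʳ x) (ℚ.+-monoˡ-≤ (ℚ.- x) x≤y)
    z≤δ : y ℚ.- x ℚ.≤ δ
    z≤δ = subst (y ℚ.- x ℚ.≤_) (solve 2 (λ x d → x :+ d :- x := d) refl x δ)
      (ℚ.+-monoˡ-≤ (ℚ.- x) (ℚ.<⇒≤ (ℚ.≰⇒> x+δ≰y)))

seq-^ℝ : ∀ α i j → seq (α ^ℝ i) j ≡ seq α j ^ i
seq-^ℝ α zero    j = refl
seq-^ℝ α (suc i) j = cong (seq α j ℚ.*_) (seq-^ℝ α i j)

seq-weighted : ∀ c α i j → seq (fromℕ c *ℝ α ^ℝ i) j ≡ ι c ℚ.* seq α j ^ i
seq-weighted c α i j = cong (ι c ℚ.*_) (seq-^ℝ α i j)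

seq-weighted-sumℝ : ∀ {m} (c e : Vector ℕ m) α j →
  seq (sumℝ (λ i → fromℕ (c i) *ℝ α ^ℝ e i)) j ≡ sumℚ (λ i → ι (c i) ℚ.* seq α j ^ e i)
seq-weighted-sumℝ {zero}  c e α j = refl
seq-weighted-sumℝ {suc m} c e α j = cong₂ ℚ._+_ (seq-weighted (c Fin.zero) α (e Fin.zero) j)
  (seq-weighted-sumℝ (c ∘ Fin.suc) (e ∘ Fin.suc) α j)

-- `_≤ℝ_` is a negation, so both claims are proved by contradiction. If dominance fails at N = n -
-- d, then `dominance-gap` keeps all late terms of α above N + δ with one fixed δ > 0, which means n
-- < α + d.
dominant-difference : ∀ {m} (a : Vector ℤ (suc m)) (α : ℝ) → 0ℝ <ℝ α →
  sumℝ (λ (i : Fin m) → fromℕ ∣ a (inject₁ i) ∣ *ℝ α ^ℝ toℕ i) <ℝ fromℕ ∣ a (Fin.fromℕ m) ∣ *ℝ α ^ℝ m →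
  ∀ n d → α +ℝ fromℕ d ≤ℝ fromℕ n → d < n × Dominant a (n ℕ.∸ d)
dominant-difference {m} a α (ε₀ , 0<ε₀ , M₀ , α≥ε₀) (ε , 0<ε , M , dom) n d α+d≤n = d<n , dominant
  where
  open ℚ.≤-Reasoning
  w : Vector ℚ m
  w i = ι ∣ a (inject₁ i) ∣
  A = ι ∣ a (Fin.fromℕ m) ∣
  ε₀≤α : ∀ j → M₀ ≤ j → ε₀ ℚ.≤ seq α j
  ε₀≤α j M₀≤j = subst (ℚ._≤ seq α j) (ℚ.+-identityˡ ε₀) (α≥ε₀ j M₀≤j)

  -- If n ≤ d, the lower bound `ε₀` for the late terms of α would itself witness n < α + d.
  d<n : d < n
  d<n = ℕ.≰⇒> λ n≤d → α+d≤n (ε₀ , 0<ε₀ , M₀ , λ j M₀≤j → begin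
    ι n ℚ.+ ε₀            ≡⟨ ℚ.+-comm (ι n) ε₀ ⟩
    ε₀ ℚ.+ ι n            ≤⟨ ℚ.+-mono-≤ (ε₀≤α j M₀≤j) (ι-mono-≤ n≤d) ⟩
    seq α j ℚ.+ ι d       ∎)

  N = n ℕ.∸ d
  0<N : 0ℚ ℚ.< ι N
  0<N = 0<ι N {{ℕ.>-nonZero (ℕ.m<n⇒0<n∸m d<n)}}

  dominantℚ : ∀ j → M ≤ j → sumℚ (λ i → w i ℚ.* seq α j ^ toℕ i) ℚ.+ ε ℚ.≤ A ℚ.* seq α j ^ m
  dominantℚ j M≤j = subst₂ (λ x y → x ℚ.+ ε ℚ.≤ y)
    (seq-weighted-sumℝ (λ i → ∣ a (inject₁ i) ∣) toℕ α j) (seq-weighted ∣ a (Fin.fromℕ m) ∣ α m j) (dom j M≤j)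

  Gap : Set
  Gap = ∃[ δ ] 0ℚ ℚ.< δ × (∀ y → 0ℚ ℚ.< y → sumℚ (λ i → w i ℚ.* y ^ toℕ i) ℚ.+ ε ℚ.≤ A ℚ.* y ^ m → ι N ℚ.+ δ ℚ.≤ y)

  ¬gap : ¬ Gap
  ¬gap (δ , 0<δ , gap) = α+d≤n (δ , 0<δ , M₀ ℕ.⊔ M , λ j M≤j → begin
    ι n ℚ.+ δ                     ≡⟨ cong (λ t → ι t ℚ.+ δ) (ℕ.m∸n+n≡m (ℕ.<⇒≤ d<n)) ⟨
    ι (N ℕ.+ d) ℚ.+ δ             ≡⟨ cong (ℚ._+ δ) (ι-+ N d) ⟩
    ι N ℚ.+ ι d ℚ.+ δ             ≡⟨ swapʳ (ι N) (ι d) δ ⟩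
    ι N ℚ.+ δ ℚ.+ ι d
      ≤⟨ ℚ.+-monoˡ-≤ (ι d) (gap (seq α j) (ℚ.<-≤-trans 0<ε₀ (ε₀≤α j (ℕ.m⊔n≤o⇒m≤o M₀ M M≤j))) (dominantℚ j (ℕ.m⊔n≤o⇒n≤o M₀ M M≤j))) ⟩
    seq α j ℚ.+ ι d               ∎)
    where
    swapʳ : ∀ x y z → x ℚ.+ y ℚ.+ z ≡ x ℚ.+ z ℚ.+ y
    swapʳ = solve 3 (λ x y z → x :+ y :+ z := x :+ z :+ y) refl
      where open ℚ.+-*-Solver

  not-dominantℚ : ∣ a (Fin.fromℕ m) ∣ ℕ.* N ℕ.^ m ≤ sumℕ (λ (i : Fin m) → ∣ a (inject₁ i) ∣ ℕ.* N ℕ.^ toℕ i) →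
    A ℚ.* ι N ^ m ℚ.≤ sumℚ (λ i → w i ℚ.* ι N ^ toℕ i)
  not-dominantℚ not-dom = subst₂ ℚ._≤_
    (trans (ι-* ∣ a (Fin.fromℕ m) ∣ (N ℕ.^ m)) (cong (A ℚ.*_) (ι-^ N m)))
    (trans (ι-sum (λ (i : Fin m) → ∣ a (inject₁ i) ∣ ℕ.* N ℕ.^ toℕ i))
      (sumℚ-cong (λ i → ι (∣ a (inject₁ i) ∣ ℕ.* N ℕ.^ toℕ i)) (λ i → w i ℚ.* ι N ^ toℕ i)
        (λ i → trans (ι-* ∣ a (inject₁ i) ∣ (N ℕ.^ toℕ i)) (cong (w i ℚ.*_) (ι-^ N (toℕ i))))))
    (ι-mono-≤ not-dom)

  dominant : Dominant a N
  dominant = ℕ.≰⇒> λ not-dom →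
    ¬gap (dominance-gap w (λ i → 0≤ι ∣ a (inject₁ i) ∣) (0≤ι ∣ a (Fin.fromℕ m) ∣) 0<ε 0<N (not-dominantℚ not-dom))

-- Factorisations of f

-- Trailing zeros are stripped, so `b` is the leading coefficient and the list has the shape that
-- `∃-solution` takes.
NonConstant : Polynomial → Set
NonConstant h = ∃[ a ] ∃[ f ] ∃[ b ] b ≢ 0ℤ × h ≈ₚ a ∷ f ++ b ∷ []

constant⊎nonConstant : ∀ h → (∃[ b ] h ≈ₚ b ∷ []) ⊎ NonConstant h
constant⊎nonConstant []      = inj₁ (0ℤ , λ { zero → refl ; (suc _) → refl })
constant⊎nonConstant (a ∷ h) with constant⊎nonConstant h
... | inj₂ (a′ , f , b , b≢0 , h≈) = inj₂ (a , a′ ∷ f , b , b≢0 , λ { zero → refl ; (suc i) → h≈ i })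
... | inj₁ (b , h≈b) with b ℤ.≟ 0ℤ
...   | no  b≢0  = inj₂ (a , [] , b , b≢0 , λ { zero → refl ; (suc i) → h≈b i })
...   | yes refl = inj₁ (a , λ { zero → refl ; (suc zero) → h≈b zero ; (suc (suc i)) → h≈b (suc i) })

∣coeff⇒∣content : ∀ {c} f → (∀ i → c ℤ.∣ coeff f i) → c ℤ.∣ content f
∣coeff⇒∣content {c} []      c∣f = c∣f 0
∣coeff⇒∣content {c} (a ∷ f) c∣f =
  ℤ.gcd-greatest {a} {content f} {c} (c∣f 0) (∣coeff⇒∣content {c} f (c∣f ∘ suc))

∣coeff-constant : ∀ {h b} → h ≈ₚ b ∷ [] → ∀ i → b Signed.∣ coeff h i
∣coeff-constant {b = b} h≈b zero    = subst (b Signed.∣_) (sym (h≈b 0)) Signed.∣-refl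
∣coeff-constant {b = b} h≈b (suc i) = subst (b Signed.∣_) (sym (h≈b (suc i))) (Signed.∣ᵤ⇒∣ (∣ b ∣ ℕ.∣0))

primitive-divisor : ∀ {f b} → Primitive f → (∀ i → b Signed.∣ coeff f i) → ∣ b ∣ ≡ 1
primitive-divisor {f} {b} prim b∣f =
  ℕ.∣1⇒≡1 (subst (b ℤ.∣_) prim (∣coeff⇒∣content {b} f (λ i → Signed.∣⇒∣ᵤ (b∣f i))))

∣i∣≡1⇒i*i≡1 : ∀ i → ∣ i ∣ ≡ 1 → i ℤ.* i ≡ 1ℤ
∣i∣≡1⇒i*i≡1 (+ 1)        refl = refl
∣i∣≡1⇒i*i≡1 (ℤ.-[1+ 0 ]) refl = refl

-- An integer of absolute value 1 is its own inverse.
constant-unit : ∀ {h b} → h ≈ₚ b ∷ [] → ∣ b ∣ ≡ 1 → h ∣ₚ 1ℤ ∷ []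
constant-unit {h} {b} h≈b ∣b∣≡1 = record { quotient = b ∷ [] ; equality = equality }
  where
  equality : (b ∷ []) *ₚ h ≈ₚ 1ℤ ∷ []
  equality zero    = trans (coeff-*ₚ-zero (b ∷ []) h) (trans (cong (b ℤ.*_) (h≈b 0)) (∣i∣≡1⇒i*i≡1 b ∣b∣≡1))
  equality (suc i) = trans (coeff-∷-*ₚ b [] h i) (trans (ℤ.+-identityʳ _) (trans (cong (b ℤ.*_) (h≈b (suc i))) (ℤ.*-zeroʳ b)))

-- If |h(n)| ≤ d, the descent with N = n - d forces `s 0` to vanish for every solution, whereas
-- `∃-solution` provides one with `s 0` nonzero.
nonConstant-factor-large : ∀ {m} (a : Vector ℤ (suc (suc m))) n d → d < n → Dominant a (n ℕ.∸ d) →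
  ∀ h J → (∀ s → Solves J h s → polynomial a ∙ s ≡ 0ℤ) → NonConstant h →
  eval h (+ n) ≢ 0ℤ → d < ∣ eval h (+ n) ∣
nonConstant-factor-large a n d d<n dom h J factor (c , f , b , b≢0 , h≈) h[n]≢0
  with ∃-solution c f b b≢0 J
... | s , sol , s₀≢0 = ℕ.≰⇒> λ h[n]≤d → s₀≢0 (solution₀≡0 a (n ℕ.∸ d) d {{N≢0}} dom h J factor
    (h[n]≢0 ∘ trans (cong (λ x → eval h (+ x)) n≡N+d))
    (subst (λ x → ∣ eval h (+ x) ∣ ≤ d) n≡N+d h[n]≤d)
    s (solves-cong (c ∷ f ++ b ∷ []) h s (sym ∘ h≈) sol))
  where
  n≡N+d : n ≡ n ℕ.∸ d ℕ.+ d
  n≡N+d = sym (ℕ.m∸n+n≡m (ℕ.<⇒≤ d<n))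
  N≢0 : ℕ.NonZero (n ℕ.∸ d)
  N≢0 = ℕ.>-nonZero (ℕ.m<n⇒0<n∸m d<n)

-- Values of the factors at n and irreducibility

∤-prime⇒coprime : ∀ {p x} → Prime p → ¬ (p ℕ.∣ x) → Coprime x p
∤-prime⇒coprime pr p∤x (i∣x , i∣p) with prime⇒irreducible pr i∣p
... | inj₁ i≡1  = i≡1
... | inj₂ refl = contradiction i∣x p∤x

∣p^k*d⇒∣d : ∀ {p x} → Prime p → ¬ (p ℕ.∣ x) → ∀ k d → x ℕ.∣ p ℕ.^ k ℕ.* d → x ℕ.∣ d
∣p^k*d⇒∣d {p} {x} pr p∤x zero    d x∣ = subst (x ℕ.∣_) (ℕ.*-identityˡ d) x∣
∣p^k*d⇒∣d {p} {x} pr p∤x (suc k) d x∣ = ∣p^k*d⇒∣d pr p∤x k d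
  (Coprimality.coprime-divisor (∤-prime⇒coprime pr p∤x) (subst (x ℕ.∣_) (ℕ.*-assoc p (p ℕ.^ k) d) x∣))

p^1+k∤p^k*d : ∀ {p} → Prime p → ∀ k {d} → ¬ (p ℕ.∣ d) → ¬ (p ℕ.^ suc k ℕ.∣ p ℕ.^ k ℕ.* d)
p^1+k∤p^k*d {p} pr k {d} p∤d ∣pᵏd = p∤d (ℕ.*-cancelˡ-∣ (p ℕ.^ k) {{ℕ.m^n≢0 p k {{prime⇒nonZero pr}}}}
  (subst (ℕ._∣ p ℕ.^ k ℕ.* d) (ℕ.*-comm p (p ℕ.^ k)) ∣pᵏd))

abs-eval-*ₚ : ∀ f g h x → f ≈ₚ g *ₚ h → ∣ eval g x ∣ ℕ.* ∣ eval h x ∣ ≡ ∣ eval f x ∣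
abs-eval-*ₚ f g h x f≈gh = begin
  ∣ eval g x ∣ ℕ.* ∣ eval h x ∣     ≡⟨ ℤ.abs-* (eval g x) (eval h x) ⟨
  ∣ eval g x ℤ.* eval h x ∣         ≡⟨ cong ∣_∣ (eval-*ₚ g h x) ⟨
  ∣ eval (g *ₚ h) x ∣               ≡⟨ cong ∣_∣ (eval-cong f (g *ₚ h) x f≈gh) ⟨
  ∣ eval f x ∣                      ∎
  where open ≡-Reasoning

-- For k = 1, two values divisible by p would give p² ∣ p d. For k > 1, the shift to `n` turns the
-- hypotheses on derivatives into those of `one-unit-constant`.
one-unit-value : ∀ {p} → Prime p → ∀ f g h n d k ℓ → f ≈ₚ g *ₚ h → 1 ≤ k → 1 ≤ ℓ → ¬ (p ℕ.∣ d) →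
  ∣ eval f n ∣ ≡ p ℕ.^ k ℕ.* d → gcd k ℓ ≡ 1 →
  (∀ i → i < ℓ → + (p ℕ.^ k) ℤ.∣ dividedDerivative i f n) →
  (1 < k → ¬ (+ p ℤ.∣ dividedDerivative ℓ f n)) →
  p ℕ.∣ ∣ eval g n ∣ → p ℕ.∣ ∣ eval h n ∣ → ⊥
one-unit-value {p} pr f g h n d 1 ℓ f≈gh _ _ p∤d f[n]≡ _ _ _ p∣g p∣h =
  p^1+k∤p^k*d pr 1 p∤d (subst₂ ℕ._∣_ (cong (p ℕ.*_) (sym (ℕ.*-identityʳ p)))
    (trans (abs-eval-*ₚ f g h n f≈gh) f[n]≡) (ℕ.*-pres-∣ p∣g p∣h))
one-unit-value {p} pr f g h n d k@(suc (suc _)) ℓ f≈gh _ 1≤ℓ p∤d f[n]≡ gcd≡1 pᵏ∣ p∤ p∣g p∣h =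
  one-unit-constant (taylor n g) (taylor n h) (Coprimality.sym (Coprimality.gcd≡1⇒coprime gcd≡1))
    (λ i i<ℓ → subst (+ (p ℕ.^ k) Signed.∣_) (derivative≡ i) (Signed.∣ᵤ⇒∣ (pᵏ∣ i i<ℓ)))
    (λ p∣ → p∤ (s≤s (s≤s z≤n)) (Signed.∣⇒∣ᵤ (subst (+ p Signed.∣_) (sym (derivative≡ ℓ)) p∣)))
    (λ p∣ → p^1+k∤p^k*d pr k p∤d (subst (p ℕ.^ suc k ℕ.∣_) (trans (cong ∣_∣ constant≡) f[n]≡) (Signed.∣⇒∣ᵤ p∣)))
    (subst (+ p Signed.∣_) (sym (coeff-taylor-0 n g)) (Signed.∣ᵤ⇒∣ p∣g))
    (subst (+ p Signed.∣_) (sym (coeff-taylor-0 n h)) (Signed.∣ᵤ⇒∣ p∣h))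
  where
  open NewtonPolygon pr k ℓ {{ℕ.>-nonZero 1≤ℓ}}
  coeff≡ : ∀ i → coeff (taylor n f) i ≡ coeff (taylor n g *ₚ taylor n h) i
  coeff≡ i = trans (taylor-cong n f (g *ₚ h) f≈gh i) (taylor-*ₚ n g h i)
  derivative≡ : ∀ i → dividedDerivative i f n ≡ coeff (taylor n g *ₚ taylor n h) i
  derivative≡ i = trans (dividedDerivative≡coeff-taylor i f n) (coeff≡ i)
  constant≡ : coeff (taylor n g *ₚ taylor n h) 0 ≡ eval f n
  constant≡ = trans (sym (coeff≡ 0)) (coeff-taylor-0 n f)

-- Two nonconstant factors would both have values at `n` exceeding `d` in absolute value. One of
-- these values is prime to p and divides p^k d, hence divides d, a contradiction.
dominant⇒irreducible : ∀ {m} (a : Vector ℤ (suc (suc m))) → Primitive (polynomial a) →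
  ∀ n d k ℓ p → d < n → Dominant a (n ℕ.∸ d) → 1 ≤ d → 1 ≤ k → 1 ≤ ℓ → Prime p → ¬ (p ℕ.∣ d) →
  ∣ eval (polynomial a) (+ n) ∣ ≡ p ℕ.^ k ℕ.* d →
  gcd k ℓ ≡ 1 →
  (∀ i → i < ℓ → + (p ℕ.^ k) ℤ.∣ dividedDerivative i (polynomial a) (+ n)) →
  (1 < k → ¬ (+ p ℤ.∣ dividedDerivative ℓ (polynomial a) (+ n))) →
  Irreducible (polynomial a)
dominant⇒irreducible a prim n d k ℓ p d<n dom 1≤d 1≤k 1≤ℓ pr p∤d f[n]≡ gcd≡1 pᵏ∣ p∤ =
  record { p∤1 = not-unit ; split-∣1 = λ {g} {h} → split g h }
  where
  f = polynomial a
  x = + n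

  values : ∀ g h → f ≈ₚ g *ₚ h → ∣ eval g x ∣ ℕ.* ∣ eval h x ∣ ≡ p ℕ.^ k ℕ.* d
  values g h f≈gh = trans (abs-eval-*ₚ f g h x f≈gh) f[n]≡

  -- An inverse of f would make f(n) a unit, but p divides f(n) because k ≥ 1.
  not-unit : ¬ (f ∣ₚ 1ℤ ∷ [])
  not-unit f∣1 = contradiction (ℕ.∣1⇒≡1 p∣1) λ p≡1 → ℕ.<-irrefl (sym p≡1) (ℕ.nonTrivial⇒n>1 p {{prime⇒nonTrivial pr}})
    where
    q = _∣ʳ_.quotient f∣1
    q[n]f[n]≡1 : eval q x ℤ.* eval f x ≡ 1ℤ
    q[n]f[n]≡1 = trans (sym (eval-*ₚ q f x)) (trans (eval-cong (q *ₚ f) (1ℤ ∷ []) x (_∣ʳ_.equality f∣1))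
      (trans (cong (λ y → 1ℤ ℤ.+ y) (ℤ.*-zeroʳ x)) (ℤ.+-identityʳ 1ℤ)))
    p∣f[n] : p ℕ.∣ ∣ eval f x ∣
    p∣f[n] = subst (p ℕ.∣_) (sym f[n]≡) (ℕ.∣m⇒∣m*n d (subst (λ e → p ℕ.∣ p ℕ.^ e) (ℕ.m+[n∸m]≡n 1≤k) (ℕ.m∣m*n (p ℕ.^ (k ℕ.∸ 1)))))
    p∣1 : p ℕ.∣ 1
    p∣1 = subst (p ℕ.∣_) (trans (sym (ℤ.abs-* (eval q x) (eval f x))) (cong ∣_∣ q[n]f[n]≡1)) (ℕ.∣n⇒∣m*n ∣ eval q x ∣ p∣f[n])

  pᵏd≢0 : p ℕ.^ k ℕ.* d ≢ 0
  pᵏd≢0 = ℕ.≢-nonZero⁻¹ _ {{ℕ.m*n≢0 (p ℕ.^ k) d {{ℕ.m^n≢0 p k {{prime⇒nonZero pr}}}} {{ℕ.>-nonZero 1≤d}}}}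

  small-if-unit : ∀ {y} → ¬ (p ℕ.∣ ∣ y ∣) → ∣ y ∣ ℕ.∣ p ℕ.^ k ℕ.* d → ∣ y ∣ ≤ d
  small-if-unit p∤y y∣ = ℕ.∣⇒≤ {{ℕ.>-nonZero 1≤d}} (∣p^k*d⇒∣d pr p∤y k d y∣)

  split : ∀ g h → f ≈ₚ g *ₚ h → g ∣ₚ 1ℤ ∷ [] ⊎ h ∣ₚ 1ℤ ∷ []
  split g h f≈gh with constant⊎nonConstant g | constant⊎nonConstant h
  -- A constant factor divides every coefficient of f, so primitivity makes it ±1.
  ... | inj₁ (b , g≈b) | _ = inj₁ (constant-unit g≈b (primitive-divisor {f} prim λ i →
    subst (b Signed.∣_) (sym (f≈gh i)) (∣*ₚ g h i λ j l _ → Signed.∣m⇒∣m*n (coeff h l) (∣coeff-constant {g} g≈b j))))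
  ... | inj₂ _ | inj₁ (b , h≈b) = inj₂ (constant-unit h≈b (primitive-divisor {f} prim λ i →
    subst (b Signed.∣_) (sym (f≈gh i)) (∣*ₚ g h i λ j l _ → Signed.∣n⇒∣m*n (coeff g j) (∣coeff-constant {h} h≈b l))))
  ... | inj₂ g-nonconst | inj₂ h-nonconst = ⊥-elim absurd
    where
    g[n]≢0 : eval g x ≢ 0ℤ
    g[n]≢0 g[n]≡0 = pᵏd≢0 (trans (sym (values g h f≈gh)) (cong (λ y → ∣ y ∣ ℕ.* ∣ eval h x ∣) g[n]≡0))
    h[n]≢0 : eval h x ≢ 0ℤ
    h[n]≢0 h[n]≡0 = pᵏd≢0 (trans (sym (values g h f≈gh))
      (trans (cong (λ y → ∣ eval g x ∣ ℕ.* ∣ y ∣) h[n]≡0) (ℕ.*-zeroʳ ∣ eval g x ∣)))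
    large-g : d < ∣ eval g x ∣
    large-g = nonConstant-factor-large a n d d<n dom g (length h)
      (λ s → solves-*ₚʳ f g h {s} f≈gh) g-nonconst g[n]≢0
    large-h : d < ∣ eval h x ∣
    large-h = nonConstant-factor-large a n d d<n dom h (length g)
      (λ s → solves-*ₚˡ f g h {s} f≈gh) h-nonconst h[n]≢0
    absurd : ⊥
    absurd with p ℕ.∣? ∣ eval g x ∣ | p ℕ.∣? ∣ eval h x ∣
    ... | no p∤g | _ = ℕ.<⇒≱ large-g (small-if-unit {eval g x} p∤g
      (subst (∣ eval g x ∣ ℕ.∣_) (values g h f≈gh) (ℕ.m∣m*n ∣ eval h x ∣)))
    ... | yes _ | no p∤h = ℕ.<⇒≱ large-h (small-if-unit {eval h x} p∤h
      (subst (∣ eval h x ∣ ℕ.∣_) (values g h f≈gh) (ℕ.n∣m*n ∣ eval g x ∣)))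
    ... | yes p∣g | yes p∣h = one-unit-value pr f g h x d k ℓ f≈gh 1≤k 1≤ℓ p∤d f[n]≡ gcd≡1 pᵏ∣ p∤ p∣g p∣h

theorem1 : (m : ℕ) (a : Vector ℤ (suc m)) → Primitive (polynomial a) →
    (α : ℝ) → 0ℝ <ℝ α →
    sumℝ (λ (i : Fin m) → fromℕ ∣ a (inject₁ i) ∣ *ℝ α ^ℝ toℕ i) <ℝ fromℕ ∣ a (Fin.fromℕ m) ∣ *ℝ α ^ℝ m →
    (n d k ℓ p : ℕ) → 1 ≤ n → 1 ≤ d → 1 ≤ k → 1 ≤ ℓ → ℓ ≤ m →
    Prime p → ¬ (p ℕ.∣ d) →
    α +ℝ fromℕ d ≤ℝ fromℕ n →
    eval (polynomial a) (+ n) ≡ + (p ℕ.^ k ℕ.* d) ⊎ eval (polynomial a) (+ n) ≡ ℤ.- (+ (p ℕ.^ k ℕ.* d)) →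
    gcd k ℓ ≡ 1 →
    (∀ i → i < ℓ → + (p ℕ.^ k) ℤ.∣ dividedDerivative i (polynomial a) (+ n)) →
    (1 < k → ¬ (+ p ℤ.∣ dividedDerivative ℓ (polynomial a) (+ n))) →
    Irreducible (polynomial a)
-- Constant polynomials are excluded by 1 ≤ ℓ ≤ m.
theorem1 zero a prim α 0<α dom n d k ℓ p 1≤n 1≤d 1≤k 1≤ℓ ℓ≤m = contradiction (ℕ.≤-trans 1≤ℓ ℓ≤m) λ ()
theorem1 (suc m) a prim α 0<α dom n d k ℓ p 1≤n 1≤d 1≤k 1≤ℓ ℓ≤m pr p∤d α+d≤n f[n]≡± gcd≡1 pᵏ∣ p∤ =
  dominant⇒irreducible a prim n d k ℓ p (proj₁ d<n,dominant) (proj₂ d<n,dominant) 1≤d 1≤k 1≤ℓ pr p∤d f[n]≡ gcd≡1 pᵏ∣ p∤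
  where
  d<n,dominant : d < n × Dominant a (n ℕ.∸ d)
  d<n,dominant = dominant-difference a α 0<α dom n d α+d≤n
  f[n]≡ : ∣ eval (polynomial a) (+ n) ∣ ≡ p ℕ.^ k ℕ.* d
  f[n]≡ = [ cong ∣_∣ , (λ eq → trans (cong ∣_∣ eq) (ℤ.∣-i∣≡∣i∣ (+ (p ℕ.^ k ℕ.* d)))) ]′ f[n]≡±
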